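{- $\overline{\theta}(K_{6,8}) = 3$, where $K_{6,8}$ is the complete bipartite graph with parts of sizes 6 and 8.
   Context: The geometric thickness $\overline{\theta}(G)$ of a graph $G$ is the smallest integer $k$ such that the vertices of $G$ can be placed at distinct points of the plane, each edge drawn as the straight line segment joining its endpoints, and each edge assigned to one of $k$ layers so that no two edges assigned to the same layer cross (i.e. two edges on the same layer meet at most in a common endpoint).
   Formalization: The vertices are placed at points of the plane with rational coordinates only; the lower bound is thus stated for rational placements (the real case follows by slightly perturbing the finitely many points). -}

module Defs where

open import Data.Nat using (ℕ; _≤_)
open import Data.Fin using (Fin)
open import Data.Sum using (_⊎_; inj₁; inj₂)
open import Data.Product using (_×_; _,_; Σ; ∃; proj₁; proj₂)
open import Data.Rational using (ℚ; 0ℚ; 1ℚ; _+_; _*_; _-_) renaming (_≤_ to _≤ℚ_)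
open import Relation.Binary.PropositionalEquality using (_≡_; _≢_)
open import Relation.Nullary using (¬_)

Point : Set
Point = ℚ × ℚ

OnSegment : Point → Point → Point → Set
OnSegment (px , py) (ax , ay) (bx , by) =
  Σ ℚ λ t → (0ℚ ≤ℚ t) × (t ≤ℚ 1ℚ)
    × (px ≡ (1ℚ - t) * ax + t * bx)
    × (py ≡ (1ℚ - t) * ay + t * by)

record Graph : Set₁ where
  field
    V    : Set
    E    : Set
    ends : E → V × V

open Graph public

IsEnd : (G : Graph) → V G → E G → Set
IsEnd G v e = (v ≡ proj₁ (ends G e)) ⊎ (v ≡ proj₂ (ends G e))

record GeometricDrawing (G : Graph) (k : ℕ) : Set where
  field
    pos      : V G → Point
    pos-inj  : ∀ u v → pos u ≡ pos v → u ≡ v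
    layer    : E G → Fin k
    noCross  : ∀ e e' → e ≢ e' → layer e ≡ layer e' →
               ∀ p → OnSegment p (pos (proj₁ (ends G e))) (pos (proj₂ (ends G e))) →
                     OnSegment p (pos (proj₁ (ends G e'))) (pos (proj₂ (ends G e'))) →
               Σ (V G) λ v → IsEnd G v e × IsEnd G v e' × (p ≡ pos v)

GeometricThicknessIs : Graph → ℕ → Set
GeometricThicknessIs G k = GeometricDrawing G k × (∀ j → GeometricDrawing G j → k ≤ j)

K : ℕ → ℕ → Graph
K m n = record { V = Fin m ⊎ Fin n ; E = Fin m × Fin n ; ends = λ { (i , j) → inj₁ i , inj₂ j } }

{-# OPTIONS --safe #-}

-- Lower bound. Suppose two layers suffice. Perturb the n = 14 points so that no three are collinear, and
-- extend each layer to a triangulation with E edges and T triangles. An edge that is not the steepest one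
-- leaving its left end starts a triangle, so E ≤ T + n − 1. Each triangle has zero or two bichromatic sides;
-- counting sides, with weight 1 if bichromatic and 2 otherwise, gives 4T + H₁ + 2H₂ ≤ 4E − 2B, where B is the
-- number of bichromatic edges, and H₁ and H₂ count the bichromatic and the monochromatic hull edges. Hence
-- 2B + H₁ + 2H₂ ≤ 4(n − 1). Bichromatic hull edges belong to both triangulations, so the two values of B add
-- up to at least 48 + H₁. Therefore 96 + 4(H₁ + H₂) ≤ 8 · 13, but the hull has at least three edges.
--
-- Upper bound. Put one part on the y-axis and the other on the x-axis, three points on either side.
module Submission where

-- Euler's bound alone is inconclusive: a planar bipartite graph on 14 vertices has at most 2 · 14 -
-- 4 = 24 edges, and two of them could hold exactly the 48 edges of `K 6 8`. The contradiction has
-- to come from the convex hull, which is common to all triangulations of the same points.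
--
-- Faces and Euler's formula never appear. A triangle is an empty counterclockwise triple of
-- adjacent vertices, and the counting uses only inequalities between sums over ordered pairs and
-- triples. The geometry behind it is expressed by orientation signs, so that each statement about
-- five points is decided by running through sign tables.
--
-- The perturbation must not create crossings within a layer. A convex quadrilateral of perturbed
-- points is therefore traced back to two closed segments that meet in the original drawing, even if
-- the four original points are collinear; the drawing forbids this for edges of one layer without a
-- common endpoint.

open import Defs
open import Data.Bool using (Bool; true; false; not; _∧_; _∨_; _xor_; if_then_else_)
open import Data.Bool.ListAction using (and; all; any)
import Data.Bool.Properties as Bool
open import Data.Empty using (⊥; ⊥-elim)
open import Data.Fin using (Fin; zero; suc; splitAt; join; _≟_)
open import Data.Fin.Patterns using (0F; 1F; 2F; 3F; 4F; 5F)
open import Data.Fin.Properties using (all?; any?; join-splitAt; suc-injective; 0≢1+n)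
open import Data.List using (List; []; _∷_; map; allFin; cartesianProduct)
open import Data.List.Membership.Propositional using (find)
open import Data.List.Membership.Propositional.Properties using (∈-allFin; ∈-cartesianProduct⁺)
open import Data.List.Relation.Unary.All as All using (All; []; _∷_)
import Data.List.Relation.Unary.All.Properties as All
open import Data.List.Relation.Unary.AllPairs using ([]; _∷_; allPairs?)
open import Data.List.Relation.Unary.Any as Any using (Any; here; there)
open import Data.List.Relation.Unary.Unique.Propositional using (Unique)
import Data.List.Relation.Unary.Unique.Propositional.Properties as Unique
open import Data.Nat as ℕ using (ℕ; zero; suc; s≤s; z≤n)
import Data.Nat.Properties as ℕ
open import Data.Product using (_×_; _,_; proj₁; proj₂; Σ; ∃; ∃₂)
open import Data.Product.Properties using (≡-dec)
open import Data.Sum as Sum using (_⊎_; inj₁; inj₂)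
open import Data.Unit using (⊤; tt)
open import Data.Vec as Vec using (Vec; []; _∷_; lookup)
open import Data.Vec.Properties using (lookup-map)
open import Function using (_∘_; id; flip)
open import Level using (0ℓ)
open import Relation.Binary using (Decidable; Tri; tri<; tri≈; tri>)
open import Relation.Binary.PropositionalEquality
open import Relation.Nullary using (¬_; Dec; yes; no; does; contradiction)
open import Relation.Nullary.Decidable
  using (True; toWitness; from-yes; dec⇒maybe; ¬?; _×-dec_; _⊎-dec_; _→-dec_)
import Relation.Unary as U
open import Tactic.RingSolver using (solve-∀)
open import Tactic.RingSolver.Core.AlmostCommutativeRing using (AlmostCommutativeRing; fromCommutativeRing)

-- Orientations of point sets

-- The affine relation [abc] − [abd] + [acd] − [bcd] = 0 forbids alternating signs.
acyclic₄ : (abc abd acd bcd : Bool) → Bool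
acyclic₄ abc abd acd bcd = (abc xor not abd) ∨ (abc xor acd) ∨ (abc xor not bcd)

-- Signs compatible with [tsp][tqr] − [tsq][tpr] + [tsr][tpq] = 0.
plücker₅ : (tsp tsq tsr tpq tpr tqr : Bool) → Bool
plücker₅ tsp tsq tsr tpq tpr tqr = (x xor not y) ∨ (x xor z)
  where
  x = tsp xor tqr
  y = tsq xor tpr
  z = tsr xor tpq

record Chirotope (V : Set) : Set where
  field
    ccw        : V → V → V → Bool
    degenerate : ∀ a b → ccw a a b ≡ false
    rotate     : ∀ a b c → ccw a b c ≡ ccw b c a
    reverse    : ∀ {a b c} → Unique (a ∷ b ∷ c ∷ []) → ccw b a c ≡ not (ccw a b c)
    acyclic    : ∀ {a b c d} → Unique (a ∷ b ∷ c ∷ d ∷ []) →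
                 acyclic₄ (ccw a b c) (ccw a b d) (ccw a c d) (ccw b c d) ≡ true
    plücker    : ∀ {t s p q r} → Unique (t ∷ s ∷ p ∷ q ∷ r ∷ []) →
                 plücker₅ (ccw t s p) (ccw t s q) (ccw t s r)
                          (ccw t p q) (ccw t p r) (ccw t q r) ≡ true

PairTable : ℕ → Set
PairTable zero    = ⊤
PairTable (suc n) = Vec Bool n × PairTable n

-- One bit for each increasing triple, so ten bits for five points; `sign₃` recovers the other
-- triples by antisymmetry.
Table : ℕ → Set
Table zero    = ⊤
Table (suc n) = PairTable n × Table n

sign₂ : ∀ {n} → PairTable n → Fin n → Fin n → Bool
sign₂ (v , t) zero    zero    = false
sign₂ (v , t) zero    (suc k) = lookup v k
sign₂ (v , t) (suc j) zero    = not (lookup v j)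
sign₂ (v , t) (suc j) (suc k) = sign₂ t j k

sign₃ : ∀ {n} → Table n → Fin n → Fin n → Fin n → Bool
sign₃ (u , t) zero    zero    _       = false
sign₃ (u , t) zero    (suc j) zero    = false
sign₃ (u , t) zero    (suc j) (suc k) = sign₂ u j k
sign₃ (u , t) (suc i) zero    zero    = false
sign₃ (u , t) (suc i) zero    (suc k) = sign₂ u k i
sign₃ (u , t) (suc i) (suc j) zero    = sign₂ u i j
sign₃ (u , t) (suc i) (suc j) (suc k) = sign₃ t i j k

everyVec : ∀ n → (Vec Bool n → Bool) → Bool
everyVec zero    P = P []
everyVec (suc n) P = everyVec n λ v → P (true ∷ v) ∧ P (false ∷ v)

everyPairTable : ∀ n → (PairTable n → Bool) → Bool
everyPairTable zero    P = P tt
everyPairTable (suc n) P = everyVec n λ v → everyPairTable n λ t → P (v , t)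

everyTable : ∀ n → (Table n → Bool) → Bool
everyTable zero    P = P tt
everyTable (suc n) P = everyPairTable n λ u → everyTable n λ t → P (u , t)

∧-split : ∀ {x y} → x ∧ y ≡ true → x ≡ true × y ≡ true
∧-split {true} {true} _ = refl , refl

everyVec-sound : ∀ n P → everyVec n P ≡ true → ∀ v → P v ≡ true
everyVec-sound zero    P eq []          = eq
everyVec-sound (suc n) P eq (true ∷ v)  = proj₁ (∧-split (everyVec-sound n _ eq v))
everyVec-sound (suc n) P eq (false ∷ v) = proj₂ (∧-split (everyVec-sound n _ eq v))

everyPairTable-sound : ∀ n P → everyPairTable n P ≡ true → ∀ t → P t ≡ true
everyPairTable-sound zero    P eq tt      = eq
everyPairTable-sound (suc n) P eq (v , t) =
  everyPairTable-sound n _ (everyVec-sound n _ eq v) t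

everyTable-sound : ∀ n P → everyTable n P ≡ true → ∀ t → P t ≡ true
everyTable-sound zero    P eq tt      = eq
everyTable-sound (suc n) P eq (u , t) =
  everyTable-sound n _ (everyPairTable-sound n _ eq u) t

everyFin : ∀ {n} → (Fin n → Bool) → Bool
everyFin {zero}  P = true
everyFin {suc n} P = P zero ∧ everyFin (P ∘ suc)

everyFin-sound : ∀ {n} (P : Fin n → Bool) → everyFin P ≡ true → ∀ i → P i ≡ true
everyFin-sound P eq zero    = proj₁ (∧-split eq)
everyFin-sound P eq (suc i) = everyFin-sound (P ∘ suc) (proj₂ (∧-split eq)) i

-- Deciding implications between orientations of five points

Atom : ℕ → Set
Atom n = Fin n × Fin n × Fin n

module _ {n : ℕ} where

  holdsIn : Table n → Atom n → Bool
  holdsIn t (i , j , k) = sign₃ t i j k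

  identify : Fin n → Fin n → Fin n → Fin n
  identify i j k = if does (k ≟ j) then i else k

  identifyAtom : Fin n → Fin n → Atom n → Atom n
  identifyAtom i j (a , b , c) = identify i j a , identify i j b , identify i j c

  _≟ₐ_ : (A B : Atom n) → Dec (A ≡ B)
  _≟ₐ_ = ≡-dec _≟_ (≡-dec _≟_ _≟_)

  -- A vertex repeated within an atom is also detected here: such an atom equals one of its reversals.
  opposite : Atom n → Atom n → Bool
  opposite (a , b , c) A = does ((b , a , c) ≟ₐ A) ∨ does ((a , c , b) ≟ₐ A) ∨ does ((c , b , a) ≟ₐ A)

  inconsistent : List (Atom n) → Bool
  inconsistent H = any (λ A → any (opposite A) H) H

  -- If positions `i` and `j` held the same vertex, the atoms of `H` would stay true after writing
  -- `i` for `j`; two opposite atoms among the results refute this.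
  separated : List (Atom n) → Fin n → Fin n → Bool
  separated H i j = does (i ≟ j) ∨ inconsistent (map (identifyAtom i j) H)

allSeparated : ∀ {n} → List (Atom n) → Bool
allSeparated H = everyFin λ i → everyFin (separated H i)

-- A filter by necessary conditions: one acyclicity relation for each four points and one Plücker
-- relation for each apex. Soundness requires only that every table coming from a chirotope passes.
valid : Table 5 → Bool
valid t = and
  ( acyclic′ 0F 1F 2F 3F ∷ acyclic′ 0F 1F 2F 4F ∷ acyclic′ 0F 1F 3F 4F
  ∷ acyclic′ 0F 2F 3F 4F ∷ acyclic′ 1F 2F 3F 4F
  ∷ plücker′ 0F 1F 2F 3F 4F ∷ plücker′ 1F 0F 2F 3F 4F ∷ plücker′ 2F 0F 1F 3F 4F
  ∷ plücker′ 3F 0F 1F 2F 4F ∷ plücker′ 4F 0F 1F 2F 3F ∷ [] )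
  where
  o = sign₃ t
  acyclic′ : (a b c d : Fin 5) → Bool
  acyclic′ a b c d = acyclic₄ (o a b c) (o a b d) (o a c d) (o b c d)
  plücker′ : (t s p q r : Fin 5) → Bool
  plücker′ t s p q r = plücker₅ (o t s p) (o t s q) (o t s r) (o t p q) (o t p r) (o t q r)

_⇒ᵇ_ : Bool → Bool → Bool
x ⇒ᵇ y = not x ∨ y

impliesIn : List (Atom 5) → List (List (Atom 5)) → Table 5 → Bool
impliesIn H C t = all (holdsIn t) H ⇒ᵇ (valid t ⇒ᵇ any (all (holdsIn t)) C)

entails : List (Atom 5) → List (List (Atom 5)) → Bool
entails H C = allSeparated H ∧ everyTable 5 (impliesIn H C)

∨-split : ∀ {x y} → x ∨ y ≡ true → x ≡ true ⊎ y ≡ true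
∨-split {true}  _  = inj₁ refl
∨-split {false} eq = inj₂ eq

⇒ᵇ-elim : ∀ {x y} → x ⇒ᵇ y ≡ true → x ≡ true → y ≡ true
⇒ᵇ-elim eq refl = eq

all-complete : ∀ {A : Set} (f : A → Bool) {xs} → All (λ x → f x ≡ true) xs → all f xs ≡ true
all-complete f []         = refl
all-complete f (px ∷ pxs) rewrite px = all-complete f pxs

all-sound : ∀ {A : Set} (f : A → Bool) xs → all f xs ≡ true → All (λ x → f x ≡ true) xs
all-sound f []       _  = []
all-sound f (x ∷ xs) eq = proj₁ (∧-split eq) ∷ all-sound f xs (proj₂ (∧-split eq))

any-sound : ∀ {A : Set} (f : A → Bool) xs → any f xs ≡ true → Any (λ x → f x ≡ true) xs
any-sound f (x ∷ xs) eq with ∨-split {f x} eq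
... | inj₁ fx  = here fx
... | inj₂ eq′ = there (any-sound f xs eq′)

and-complete : ∀ {xs} → All (_≡ true) xs → and xs ≡ true
and-complete []           = refl
and-complete (refl ∷ pxs) = and-complete pxs

does-sound : ∀ {P : Set} (d : Dec P) → does d ≡ true → P
does-sound (yes p) _ = p

module ChirotopeProperties {V : Set} (χ : Chirotope V) where
  open Chirotope χ

  O : V → V → V → Set
  O a b c = ccw a b c ≡ true

  rot : ∀ {a b c} → O a b c → O b c a
  rot {a} {b} {c} h = trans (sym (rotate a b c)) h

  ≢₁₂ : ∀ {a b c} → O a b c → a ≢ b
  ≢₁₂ {a} {b} {c} h refl with trans (sym h) (degenerate a c)
  ... | ()

  ≢₂₃ : ∀ {a b c} → O a b c → b ≢ c
  ≢₂₃ = ≢₁₂ ∘ rot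

  ≢₁₃ : ∀ {a b c} → O a b c → a ≢ c
  ≢₁₃ h eq = ≢₁₂ (rot (rot h)) (sym eq)

  distinct₃ : ∀ {a b c : V} → a ≢ b → b ≢ c → a ≢ c → Unique (a ∷ b ∷ c ∷ [])
  distinct₃ p q r = (p ∷ r ∷ []) ∷ (q ∷ []) ∷ [] ∷ []

  asym : ∀ {a b c} → O a b c → ¬ O b a c
  asym h h′ with trans (sym h′) (trans (reverse (distinct₃ (≢₁₂ h) (≢₂₃ h) (≢₁₃ h))) (cong not h))
  ... | ()

  total : ∀ {a b c : V} → a ≢ b → b ≢ c → a ≢ c → O a b c ⊎ O b a c
  total {a} {b} {c} p q r with ccw a b c in eq
  ... | true  = inj₁ refl
  ... | false = inj₂ (trans (reverse (distinct₃ p q r)) (cong not eq))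

  O? : ∀ a b c → Dec (O a b c)
  O? a b c = ccw a b c Bool.≟ true

  Injective : ∀ {n} → Vec V n → Set
  Injective p = ∀ i j → lookup p i ≡ lookup p j → i ≡ j

  pairs : ∀ {n} → V → Vec V n → PairTable n
  pairs a []       = tt
  pairs a (b ∷ bs) = Vec.map (ccw a b) bs , pairs a bs

  table : ∀ {n} → Vec V n → Table n
  table []       = tt
  table (a ∷ as) = pairs a as , table as

  sign₂-sound : ∀ {n} a (p : Vec V n) → Injective (a ∷ p) →
                ∀ j k → ccw a (lookup p j) (lookup p k) ≡ sign₂ (pairs a p) j k
  sign₂-sound a (b ∷ p) inj zero zero = trans (rotate a b b) (degenerate b a)
  sign₂-sound a (b ∷ p) inj zero (suc k) = sym (lookup-map k (ccw a b) p)
  sign₂-sound a (b ∷ p) inj (suc j) zero = begin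
    ccw a (lookup p j) b                 ≡⟨ trans (rotate _ _ _) (rotate _ _ _) ⟩
    ccw b a (lookup p j)                 ≡⟨ reverse (distinct₃ (0≢1 ∘ inj 0F 1F)
                                                            (1≢2 ∘ inj 1F (suc (suc j)))
                                                            (0≢2 ∘ inj 0F (suc (suc j)))) ⟩
    not (ccw a b (lookup p j))           ≡⟨ cong not (lookup-map j (ccw a b) p) ⟨
    not (lookup (Vec.map (ccw a b) p) j) ∎
    where
    open ≡-Reasoning
    0≢1 : ∀ {n} → Fin.zero {suc n} ≢ 1F
    0≢1 ()
    1≢2 : ∀ {n} {j : Fin n} → 1F ≢ suc (suc j)
    1≢2 ()
    0≢2 : ∀ {n} {j : Fin n} → 0F ≢ suc (suc j)
    0≢2 ()
  sign₂-sound a (b ∷ p) inj (suc j) (suc k) = sign₂-sound a p inj′ j k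
    where
    inj′ : Injective (a ∷ p)
    inj′ zero    zero    _ = refl
    inj′ zero    (suc j) e with () ← inj 0F (suc (suc j)) e
    inj′ (suc i) zero    e with () ← inj (suc (suc i)) 0F e
    inj′ (suc i) (suc j) e = suc-injective (inj (suc (suc i)) (suc (suc j)) e)

  sign₃-sound : ∀ {n} (p : Vec V n) → Injective p →
                ∀ i j k → ccw (lookup p i) (lookup p j) (lookup p k) ≡ sign₃ (table p) i j k
  sign₃-sound (a ∷ p) inj zero    zero    k       = degenerate a _
  sign₃-sound (a ∷ p) inj zero    (suc j) zero    =
    trans (trans (rotate _ _ _) (rotate _ _ _)) (degenerate a _)
  sign₃-sound (a ∷ p) inj zero    (suc j) (suc k) = sign₂-sound a p inj j k
  sign₃-sound (a ∷ p) inj (suc i) zero    zero    = trans (rotate _ _ _) (degenerate a _)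
  sign₃-sound (a ∷ p) inj (suc i) zero    (suc k) =
    trans (rotate _ _ _) (sign₂-sound a p inj k i)
  sign₃-sound (a ∷ p) inj (suc i) (suc j) zero    =
    trans (trans (rotate _ _ _) (rotate _ _ _)) (sign₂-sound a p inj i j)
  sign₃-sound (a ∷ p) inj (suc i) (suc j) (suc k) =
    sign₃-sound p (λ i j e → suc-injective (inj (suc i) (suc j) e)) i j k

  Holds : ∀ {n} → Vec V n → Atom n → Set
  Holds p (i , j , k) = O (lookup p i) (lookup p j) (lookup p k)

  valid-table : (p : Vec V 5) → Injective p → valid (table p) ≡ true
  valid-table p inj = and-complete
    ( ac 0F 1F 2F 3F ∷ ac 0F 1F 2F 4F ∷ ac 0F 1F 3F 4F ∷ ac 0F 2F 3F 4F ∷ ac 1F 2F 3F 4F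
    ∷ pl 0F 1F 2F 3F 4F ∷ pl 1F 0F 2F 3F 4F ∷ pl 2F 0F 1F 3F 4F
    ∷ pl 3F 0F 1F 2F 4F ∷ pl 4F 0F 1F 2F 3F ∷ [] )
    where
    unique? : (is : List (Fin 5)) → Dec (Unique is)
    unique? = allPairs? λ i j → ¬? (i ≟ j)
    o = sign₃ (table p)
    s = sign₃-sound p inj
    ac : ∀ a b c d {_ : True (unique? (a ∷ b ∷ c ∷ d ∷ []))} →
         acyclic₄ (o a b c) (o a b d) (o a c d) (o b c d) ≡ true
    ac a b c d {u} rewrite sym (s a b c) | sym (s a b d) | sym (s a c d) | sym (s b c d) =
      acyclic (Unique.map⁺ {f = lookup p} (inj _ _) (toWitness u))
    pl : ∀ a b c d e {_ : True (unique? (a ∷ b ∷ c ∷ d ∷ e ∷ []))} →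
         plücker₅ (o a b c) (o a b d) (o a b e) (o a c d) (o a c e) (o a d e) ≡ true
    pl a b c d e {u} rewrite sym (s a b c) | sym (s a b d) | sym (s a b e)
                           | sym (s a c d) | sym (s a c e) | sym (s a d e) =
      plücker (Unique.map⁺ {f = lookup p} (inj _ _) (toWitness u))

  opposite-sound : ∀ {n} (p : Vec V n) A B → opposite A B ≡ true → Holds p A → ¬ Holds p B
  opposite-sound p (a , b , c) B eq h h′ with ∨-split {does ((b , a , c) ≟ₐ B)} eq
  ... | inj₁ e with refl ← does-sound ((b , a , c) ≟ₐ B) e = asym h h′
  ... | inj₂ e with ∨-split {does ((a , c , b) ≟ₐ B)} e
  ...   | inj₁ e′ with refl ← does-sound ((a , c , b) ≟ₐ B) e′ = asym (rot h) (rot (rot (rot (rot h′))))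
  ...   | inj₂ e′ with refl ← does-sound ((c , b , a) ≟ₐ B) e′ = asym (rot (rot h)) (rot (rot h′))

  inconsistent-sound : ∀ {n} (p : Vec V n) H → inconsistent H ≡ true → ¬ All (Holds p) H
  inconsistent-sound p H eq hs with find (any-sound _ H eq)
  ... | A , A∈H , eq′ with find (any-sound _ H eq′)
  ...   | B , B∈H , opp = opposite-sound p A B opp (All.lookup hs A∈H) (All.lookup hs B∈H)

  separated-sound : ∀ {n} (p : Vec V n) {H} i j → All (Holds p) H → separated H i j ≡ true →
                    lookup p i ≡ lookup p j → i ≡ j
  separated-sound p {H} i j hs eq pi≡pj with ∨-split {does (i ≟ j)} eq
  ... | inj₁ e = does-sound (i ≟ j) e
  ... | inj₂ e = contradiction (All.map⁺ (All.map holds hs)) (inconsistent-sound p _ e)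
    where
    same : ∀ k → lookup p (identify i j k) ≡ lookup p k
    same k with k ≟ j
    ... | yes refl = pi≡pj
    ... | no _     = refl
    holds : ∀ {A} → Holds p A → Holds p (identifyAtom i j A)
    holds {a , b , c} h rewrite same a | same b | same c = h

  abstract
    -- Evaluating entails runs through all 2¹⁰ sign tables of five points; separated recovers from H that
    -- the five points are distinct.
    deduce : ∀ H C → entails H C ≡ true → (p : Vec V 5) → All (Holds p) H → Any (All (Holds p)) C
    deduce H C eq p hs =
      Any.map (λ {h} e → All.map from (all-sound (holdsIn (table p)) h e)) (any-sound _ C conclusion)
      where
      inj : Injective p
      inj i j = separated-sound p i j hs
        (everyFin-sound (separated H i)
          (everyFin-sound (λ i → everyFin (separated H i)) (proj₁ (∧-split eq)) i) j)
      to : ∀ {A} → Holds p A → holdsIn (table p) A ≡ true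
      to {i , j , k} h = trans (sym (sign₃-sound p inj i j k)) h
      from : ∀ {A} → holdsIn (table p) A ≡ true → Holds p A
      from {i , j , k} h = trans (sign₃-sound p inj i j k) h
      conclusion : any (all (holdsIn (table p))) C ≡ true
      conclusion = ⇒ᵇ-elim (⇒ᵇ-elim
        (everyTable-sound 5 (impliesIn H C)
          (proj₂ (∧-split {allSeparated H} eq)) (table p))
        (all-complete (holdsIn (table p)) (All.map to hs)))
        (valid-table p inj)

-- Triangulations of planar point sets

abstract
  -- Transitivity is required only within `P` because the rotation order about a point is transitive
  -- only on a half-plane; in those applications `P` selects points of such a half-plane.
  minimum : ∀ {n} {P : Fin n → Set} {R : Fin n → Fin n → Set} →
            U.Decidable P → Decidable R →
            (∀ {x} → ¬ R x x) →
            (∀ {x y z} → P x → P y → P z → R x y → R y z → R x z) →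
            ∃ P → ∃ λ m → P m × ∀ x → P x → ¬ R x m
  minimum {suc n} {P} {R} P? R? irr tr (i , Pi) with any? (P? ∘ suc)
  ... | no none with i
  ...   | zero  = zero , Pi , λ { zero _ → irr ; (suc x) Px _ → none (x , Px) }
  ...   | suc i = contradiction (i , Pi) none
  minimum {suc n} {P} {R} P? R? irr tr _ | yes some
    with m , Pm , min ← minimum (P? ∘ suc) (λ x y → R? (suc x) (suc y)) irr tr some
    with P? zero | R? zero (suc m)
  ... | yes P0 | yes r = zero , P0 ,
        λ { zero _ → irr ; (suc x) Px r′ → min x Px (tr Px P0 Pm r′ r) }
  ... | yes P0 | no ¬r = suc m , Pm , λ { zero _ → ¬r ; (suc x) → min x }
  ... | no ¬P0 | _     = suc m , Pm , λ { zero P0 → contradiction P0 ¬P0 ; (suc x) → min x }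

module Convexity {V : Set} (χ : Chirotope V) where
  open Chirotope χ public
  open ChirotopeProperties χ public

  -- a b c d is a convex quadrilateral in counterclockwise order, so its diagonals ac and bd cross.
  Quad : V → V → V → V → Set
  Quad a b c d = O a b c × O b c d × O c d a × O d a b

  Inside : V → V → V → V → Set
  Inside z a b c = O a b z × O b c z × O c a z

  -- The points `p`, `q`, `r` lie in the open half-plane left of `ts`, where the rotation about `t`
  -- is a linear order. `cofan-trans` is the same on the right.
  fan-trans : ∀ {t s p q r} → O t s p → O t s q → O t s r → O t p q → O t q r → O t p r
  fan-trans {t} {s} {p} {q} {r} h₁ h₂ h₃ h₄ h₅ = conclude (deduce
    ((0F , 1F , 2F) ∷ (0F , 1F , 3F) ∷ (0F , 1F , 4F) ∷ (0F , 2F , 3F) ∷ (0F , 3F , 4F) ∷ [])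
    (((0F , 2F , 4F) ∷ []) ∷ []) refl
    (t ∷ s ∷ p ∷ q ∷ r ∷ []) (h₁ ∷ h₂ ∷ h₃ ∷ h₄ ∷ h₅ ∷ []))
    where
    conclude : _ → _
    conclude (here (h ∷ [])) = h

  cofan-trans : ∀ {t s p q r} → O t p s → O t q s → O t r s → O t p q → O t q r → O t p r
  cofan-trans {t} {s} {p} {q} {r} h₁ h₂ h₃ h₄ h₅ = conclude (deduce
    ((0F , 2F , 1F) ∷ (0F , 3F , 1F) ∷ (0F , 4F , 1F) ∷ (0F , 2F , 3F) ∷ (0F , 3F , 4F) ∷ [])
    (((0F , 2F , 4F) ∷ []) ∷ []) refl
    (t ∷ s ∷ p ∷ q ∷ r ∷ []) (h₁ ∷ h₂ ∷ h₃ ∷ h₄ ∷ h₅ ∷ []))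
    where
    conclude : _ → _
    conclude (here (h ∷ [])) = h

  -- In the next lemmas the edge bd crosses the segment vz, with b on its right and d on its left.
  beyond-left : ∀ {v u w z d} → O v u w → Inside z v u w → O v z d → O u z d →
                Inside d v u w ⊎ O v w d × O z w d
  beyond-left {v} {u} {w} {z} {d} h (h₁ , h₂ , h₃) h₄ h₅ = conclude (deduce
    ((0F , 1F , 2F) ∷ (0F , 1F , 3F) ∷ (1F , 2F , 3F) ∷ (2F , 0F , 3F) ∷ (0F , 3F , 4F)
     ∷ (1F , 3F , 4F) ∷ [])
    (((0F , 1F , 4F) ∷ (1F , 2F , 4F) ∷ (2F , 0F , 4F) ∷ []) ∷ ((0F , 2F , 4F)
     ∷ (3F , 2F , 4F) ∷ []) ∷ [])
    refl (v ∷ u ∷ w ∷ z ∷ d ∷ []) (h ∷ h₁ ∷ h₂ ∷ h₃ ∷ h₄ ∷ h₅ ∷ []))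
    where
    conclude : _ → _
    conclude (here (k₁ ∷ k₂ ∷ k₃ ∷ []))    = inj₁ (k₁ , k₂ , k₃)
    conclude (there (here (k₁ ∷ k₂ ∷ []))) = inj₂ (k₁ , k₂)

  beyond-right : ∀ {v u w z b} → O v u w → Inside z v u w → O v b z → O u z b →
                 Inside b v u w ⊎ O u v b
  beyond-right {v} {u} {w} {z} {b} h (h₁ , h₂ , h₃) h₄ h₅ = conclude (deduce
    ((0F , 1F , 2F) ∷ (0F , 1F , 3F) ∷ (1F , 2F , 3F) ∷ (2F , 0F , 3F) ∷ (0F , 4F , 3F)
     ∷ (1F , 3F , 4F) ∷ [])
    (((0F , 1F , 4F) ∷ (1F , 2F , 4F) ∷ (2F , 0F , 4F) ∷ []) ∷ ((1F , 0F , 4F) ∷ []) ∷ [])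
    refl (v ∷ u ∷ w ∷ z ∷ b ∷ []) (h ∷ h₁ ∷ h₂ ∷ h₃ ∷ h₄ ∷ h₅ ∷ []))
    where
    conclude : _ → _
    conclude (here (k₁ ∷ k₂ ∷ k₃ ∷ [])) = inj₁ (k₁ , k₂ , k₃)
    conclude (there (here (k ∷ [])))    = inj₂ k

  exit-left : ∀ {v w z b d} → O v z w → Quad v b z d → O v w d → O z w d → Quad v b w d
  exit-left {v} {w} {z} {b} {d} h (q₁ , q₂ , q₃ , q₄) h₁ h₂ = conclude (deduce
    ((0F , 2F , 1F) ∷ (0F , 3F , 2F) ∷ (3F , 2F , 4F) ∷ (2F , 4F , 0F) ∷ (4F , 0F , 3F)
     ∷ (0F , 1F , 4F) ∷ (2F , 1F , 4F) ∷ [])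
    (((0F , 3F , 1F) ∷ (3F , 1F , 4F) ∷ []) ∷ [])
    refl (v ∷ w ∷ z ∷ b ∷ d ∷ []) (h ∷ q₁ ∷ q₂ ∷ q₃ ∷ q₄ ∷ h₁ ∷ h₂ ∷ []))
    where
    conclude : _ → _
    conclude (here (k₁ ∷ k₂ ∷ [])) = k₁ , k₂ , rot h₁ , q₄

  same-side : ∀ {v u z b d} → Quad v b z d → O v u z → O z u d → O u z b
  same-side {v} {u} {z} {b} {d} (q₁ , q₂ , q₃ , q₄) h₁ h₂ = conclude (deduce
    ((0F , 3F , 2F) ∷ (3F , 2F , 4F) ∷ (2F , 4F , 0F) ∷ (4F , 0F , 3F) ∷ (0F , 1F , 2F)
     ∷ (2F , 1F , 4F) ∷ [])
    (((1F , 2F , 3F) ∷ []) ∷ [])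
    refl (v ∷ u ∷ z ∷ b ∷ d ∷ []) (q₁ ∷ q₂ ∷ q₃ ∷ q₄ ∷ h₁ ∷ h₂ ∷ []))
    where
    conclude : _ → _
    conclude (here (k ∷ [])) = k

  exit-right : ∀ {v u z b d} → O v u z → Quad v b z d → O u v b → O u z b → Quad v b u d
  exit-right {v} {u} {z} {b} {d} h (q₁ , q₂ , q₃ , q₄) h₁ h₂ = conclude (deduce
    ((0F , 1F , 2F) ∷ (0F , 3F , 2F) ∷ (3F , 2F , 4F) ∷ (2F , 4F , 0F) ∷ (4F , 0F , 3F)
     ∷ (1F , 0F , 3F) ∷ (1F , 2F , 3F) ∷ [])
    (((3F , 1F , 4F) ∷ (1F , 4F , 0F) ∷ []) ∷ [])
    refl (v ∷ u ∷ z ∷ b ∷ d ∷ []) (h ∷ q₁ ∷ q₂ ∷ q₃ ∷ q₄ ∷ h₁ ∷ h₂ ∷ []))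
    where
    conclude : _ → _
    conclude (here (k₁ ∷ k₂ ∷ [])) = rot h₁ , k₁ , k₂ , q₄

  -- The segment `bd` crosses the side `uw` of the triangle `vuw`, and `d` is on the side of `v` but
  -- beyond the line `vu`. Having entered the triangle through `uw`, the segment must leave it
  -- through `vu` or `vw`. In `crosses-side₂` the point `d` is beyond the line `vw`.
  crosses-side₁ : ∀ {v u w b d} → O v u w → Quad u b w d → O u v d → Quad v d u b ⊎ Quad v b w d
  crosses-side₁ {v} {u} {w} {b} {d} h (q₁ , q₂ , q₃ , q₄) h₁ = conclude (deduce
    ((0F , 1F , 2F) ∷ (1F , 3F , 2F) ∷ (3F , 2F , 4F) ∷ (2F , 4F , 1F) ∷ (4F , 1F , 3F)
     ∷ (1F , 0F , 4F) ∷ [])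
    (((1F , 3F , 0F) ∷ (3F , 0F , 4F) ∷ []) ∷ ((0F , 3F , 2F) ∷ (3F , 2F , 4F) ∷ (2F , 4F , 0F)
     ∷ (4F , 0F , 3F) ∷ []) ∷ [])
    refl (v ∷ u ∷ w ∷ b ∷ d ∷ []) (h ∷ q₁ ∷ q₂ ∷ q₃ ∷ q₄ ∷ h₁ ∷ []))
    where
    conclude : _ → _
    conclude (here (k₁ ∷ k₂ ∷ []))                   = inj₁ (rot h₁ , q₄ , k₁ , k₂)
    conclude (there (here (k₁ ∷ k₂ ∷ k₃ ∷ k₄ ∷ []))) = inj₂ (k₁ , k₂ , k₃ , k₄)

  crosses-side₂ : ∀ {v u w b d} → O v u w → Quad u b w d → O v w d → Quad v d u b ⊎ Quad v b w d
  crosses-side₂ {v} {u} {w} {b} {d} h (q₁ , q₂ , q₃ , q₄) h₁ = conclude (deduce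
    ((0F , 1F , 2F) ∷ (1F , 3F , 2F) ∷ (3F , 2F , 4F) ∷ (2F , 4F , 1F) ∷ (4F , 1F , 3F)
     ∷ (0F , 2F , 4F) ∷ [])
    (((0F , 4F , 1F) ∷ (1F , 3F , 0F) ∷ (3F , 0F , 4F) ∷ []) ∷ ((0F , 3F , 2F)
     ∷ (4F , 0F , 3F) ∷ []) ∷ [])
    refl (v ∷ u ∷ w ∷ b ∷ d ∷ []) (h ∷ q₁ ∷ q₂ ∷ q₃ ∷ q₄ ∷ h₁ ∷ []))
    where
    conclude : _ → _
    conclude (here (k₁ ∷ k₂ ∷ k₃ ∷ []))    = inj₁ (k₁ , q₄ , k₂ , k₃)
    conclude (there (here (k₁ ∷ k₂ ∷ []))) = inj₂ (k₁ , q₂ , rot h₁ , k₂)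

-- _<_ is the order of the abscissae; right-trans and wedge say that it is the rotation order seen from a
-- point at vertical infinity.
record Configuration (n : ℕ) : Set₁ where
  field
    chirotope : Chirotope (Fin n)
  open Convexity chirotope public
  field
    _<_         : Fin n → Fin n → Set
    _<?_        : Decidable _<_
    <-asym      : ∀ {a b} → a < b → ¬ b < a
    <-trans     : ∀ {a b c} → a < b → b < c → a < c
    <-total     : ∀ {a b} → a ≢ b → a < b ⊎ b < a
    right-trans : ∀ {v a b c} → v < a → v < b → v < c → O v a b → O v b c → O v a c
    wedge       : ∀ {v u w x} → v < u → v < w → O v u w → O v u x → O v x w → v < x

record PlaneGraph {n : ℕ} (ω : Configuration n) : Set₁ where
  open Configuration ω
  field
    _~_    : Fin n → Fin n → Set
    _~?_   : Decidable _~_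
    ~-sym  : ∀ {a b} → a ~ b → b ~ a
    ~-irr  : ∀ {a} → ¬ a ~ a
    planar : ∀ {a b c d} → a ~ c → b ~ d → ¬ Quad a b c d

-- Maximality in positive form: each missing edge comes with an edge that blocks it. Since adjacency
-- is symmetric, the blocking edge can be directed from right to left.
record Maximal {n : ℕ} {ω : Configuration n} (G : PlaneGraph ω) : Set where
  open Configuration ω
  open PlaneGraph G
  field
    crossed : ∀ {a c} → a ≢ c → ¬ a ~ c → ∃₂ λ b d → b ~ d × Quad a b c d

module Triangulation {n : ℕ} {ω : Configuration n} {G : PlaneGraph ω} (M : Maximal G) where
  open Configuration ω
  open PlaneGraph G
  open Maximal M

  Empty : Fin n → Fin n → Fin n → Set
  Empty a b c = ∀ z → ¬ Inside z a b c

  Triangle : Fin n → Fin n → Fin n → Set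
  Triangle a b c = a ~ b × b ~ c × c ~ a × O a b c × Empty a b c

  Inside? : ∀ a b c z → Dec (Inside z a b c)
  Inside? a b c z = O? a b z ×-dec O? b c z ×-dec O? c a z

  Empty? : ∀ a b c → Dec (Empty a b c)
  Empty? a b c = all? (¬? ∘ Inside? a b c)

  Triangle? : ∀ a b c → Dec (Triangle a b c)
  Triangle? a b c = (a ~? b) ×-dec (b ~? c) ×-dec (c ~? a) ×-dec O? a b c ×-dec Empty? a b c

  Triangle-rot : ∀ {a b c} → Triangle a b c → Triangle b c a
  Triangle-rot (ab , bc , ca , h , e) =
    bc , ca , ab , rot h , λ { z (h₁ , h₂ , h₃) → e z (h₃ , h₁ , h₂) }

  -- With `x` before `y` in the rotation about `p`, either the sides `px` and `qy` cross or `x` lies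
  -- inside `pqy`. Hence a directed edge has at most one triangle on its left.
  no-overlap : ∀ {p q x y} → Triangle p q x → Triangle p q y → O p x y → x ≢ y → ⊥
  no-overlap (_ , _ , xp , px , _) (_ , qy , _ , py , ey) h x≢y with total (≢₂₃ px) x≢y (≢₂₃ py)
  ... | inj₁ k = planar (~-sym xp) qy (px , k , rot h , rot (rot py))
  ... | inj₂ k = ey _ (px , rot k , rot (rot h))

  apex-unique : ∀ {p q x y} → Triangle p q x → Triangle p q y → x ≡ y
  apex-unique {p} {q} {x} {y} X Y with x ≟ y
  ... | yes eq = eq
  ... | no x≢y with total (≢₁₃ (X .proj₂ .proj₂ .proj₂ .proj₁)) x≢y
                          (≢₁₃ (Y .proj₂ .proj₂ .proj₂ .proj₁))
  ...   | inj₁ h = ⊥-elim (no-overlap X Y h x≢y)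
  ...   | inj₂ h = ⊥-elim (no-overlap Y X (rot h) (x≢y ∘ sym))

  -- Two rightward edges at `v`, consecutive in slope, bound a triangle. No edge of `v` enters the
  -- angle between them, so for a point `z` in the angle maximality provides an edge that crosses
  -- `vz`.
  module Corner {v u w : Fin n} (vu : v ~ u) (vw : v ~ w) (v<u : v < u) (v<w : v < w) (h : O v u w)
                (consecutive : ∀ {x} → v ~ x → v < x → O v u x → ¬ O v x w) where

    -- Take z inside vuw minimising the angle uv, uz. An edge bd crossing vz must leave the triangle, and it
    -- cannot do so through uz without an endpoint that contradicts minimality.
    empty : Empty v u w
    empty z₀ in₀ with minimum {R = λ x y → O u y x} (Inside? v u w) (λ x y → O? u y x)
      (λ k → ≢₂₃ k refl)
      (λ { (x , _) (y , _) (z , _) xy yz → cofan-trans (rot z) (rot y) (rot x) yz xy })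
      (z₀ , in₀)
    ... | z , in-z@(z₁ , z₂ , z₃) , min with crossed (≢₁₃ z₁)
            (λ vz → consecutive vz (wedge v<u v<w h z₁ (rot z₃)) z₁ (rot z₃))
    ... | b , d , bd , q@(q₁ , q₂ , q₃ , q₄) with total u≢z (≢₁₂ q₃) u≢d
      where
      u≢z : u ≢ z
      u≢z = ≢₂₃ z₁
      u≢d : u ≢ d
      u≢d refl = asym z₁ (rot q₃)
    ... | inj₁ uzd with beyond-left h in-z (rot (rot q₃)) uzd
    ...   | inj₁ in-d        = min d in-d uzd
    ...   | inj₂ (vwd , zwd) = planar vw bd (exit-left (rot z₃) q vwd zwd)
    empty z₀ in₀ | z , in-z@(z₁ , z₂ , z₃) , min | b , d , bd , q@(q₁ , q₂ , q₃ , q₄) | inj₂ zud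
      with uzb ← same-side q z₁ zud | beyond-right h in-z q₁ uzb
    ... | inj₁ in-b = min b in-b uzb
    ... | inj₂ uvb  = planar vu bd (exit-right z₁ q uvb uzb)

    no-side-crossing : ∀ {b d} → b ~ d → ¬ (Quad v d u b ⊎ Quad v b w d)
    no-side-crossing bd (inj₁ q) = planar vu (~-sym bd) q
    no-side-crossing bd (inj₂ q) = planar vw bd q

    -- An edge `bd` blocking `uw` has `d` on the side of `v`. If `d` is `v`, this edge splits the
    -- angle at `v`; if `d` is inside `vuw`, the triangle is not empty; otherwise `bd` crosses `vu`
    -- or `vw`.
    u~w : u ~ w
    u~w with u ~? w
    ... | yes uw = uw
    ... | no ¬uw with b , d , bd , q@(q₁ , q₂ , q₃ , q₄) ← crossed (≢₂₃ h) ¬uw | d ≟ v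
    ...   | yes refl =
      ⊥-elim (consecutive (~-sym bd) (wedge v<u v<w h q₄ (rot (rot q₂))) q₄ (rot (rot q₂)))
    ...   | no d≢v with total (d≢v ∘ sym) (≢₁₂ q₄) (≢₁₂ h)
    ...     | inj₁ vdu = ⊥-elim (no-side-crossing bd (crosses-side₁ h q (rot (rot vdu))))
    ...     | inj₂ dvu with total (d≢v ∘ sym) (≢₁₂ q₃ ∘ sym) (≢₁₃ h)
    ...       | inj₁ vdw = ⊥-elim (empty d (rot dvu , rot (rot q₃) , rot (rot vdw)))
    ...       | inj₂ dvw = ⊥-elim (no-side-crossing bd (crosses-side₂ h q (rot dvw)))

    triangle : Triangle v u w
    triangle = vu , u~w , ~-sym vw , h , empty

  -- The vertex `w` is the right neighbour of `v` that follows `u` immediately in the rotation about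
  -- `v`.
  corner : ∀ {v u} → v ~ u → v < u → (∃ λ w → v ~ w × v < w × O v u w) →
           ∃ λ w → v < w × Triangle v u w
  corner {v} {u} vu v<u some
    with minimum {R = λ x y → O v x y} (λ w → (v ~? w) ×-dec (v <? w) ×-dec O? v u w) (O? v)
           (λ k → ≢₂₃ k refl)
           (λ { (_ , _ , x) (_ , _ , y) (_ , _ , z) xy yz → fan-trans x y z xy yz })
           some
  ... | w , (vw , v<w , h) , min =
    w , v<w , Corner.triangle vu vw v<u v<w h λ vx v<x vux vxw → min _ (vx , v<x , vux) vxw

-- Extending a plane graph to a maximal one

module _ {n : ℕ} {ω : Configuration n} where
  open Configuration ω
  open PlaneGraph using (_~_)

  Quad-rot : ∀ {a b c d} → Quad a b c d → Quad b c d a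
  Quad-rot (q₁ , q₂ , q₃ , q₄) = q₂ , q₃ , q₄ , q₁

  Quad? : ∀ a b c d → Dec (Quad a b c d)
  Quad? a b c d = O? a b c ×-dec O? b c d ×-dec O? c d a ×-dec O? d a b

  Crossed : PlaneGraph ω → Fin n → Fin n → Set
  Crossed G a c = ∃₂ λ b d → _~_ G b d × Quad a b c d

  infix 4 _⊆_
  _⊆_ : PlaneGraph ω → PlaneGraph ω → Set
  G ⊆ H = ∀ {a b} → _~_ G a b → _~_ H a b

  addEdge : (G : PlaneGraph ω) → ∀ {a c} → a ≢ c → ¬ Crossed G a c →
            Σ (PlaneGraph ω) λ H → G ⊆ H × _~_ H a c
  addEdge G {a} {c} a≢c uncrossed =
    record
      { _~_    = _~′_
      ; _~?_   = λ x y → (x G.~? y) ⊎-dec ((x ≟ a ×-dec y ≟ c) ⊎-dec (x ≟ c ×-dec y ≟ a))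
      ; ~-sym  = λ { (inj₁ e) → inj₁ (G.~-sym e)
                   ; (inj₂ (inj₁ (p , q))) → inj₂ (inj₂ (q , p))
                   ; (inj₂ (inj₂ (p , q))) → inj₂ (inj₁ (q , p)) }
      ; ~-irr  = λ { (inj₁ e) → G.~-irr e
                   ; (inj₂ (inj₁ (p , q))) → a≢c (trans (sym p) q)
                   ; (inj₂ (inj₂ (p , q))) → a≢c (trans (sym q) p) }
      ; planar = planar′
      } , inj₁ , inj₂ (inj₁ (refl , refl))
    where
    module G = PlaneGraph G
    _~′_ : Fin n → Fin n → Set
    x ~′ y = x G.~ y ⊎ (x ≡ a × y ≡ c) ⊎ (x ≡ c × y ≡ a)
    planar′ : ∀ {p q r s} → p ~′ r → q ~′ s → ¬ Quad p q r s
    planar′ (inj₁ e) (inj₁ f) k = G.planar e f k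
    planar′ (inj₁ e) (inj₂ (inj₁ (refl , refl))) k = uncrossed (_ , _ , G.~-sym e , Quad-rot k)
    planar′ (inj₁ e) (inj₂ (inj₂ (refl , refl))) k =
      uncrossed (_ , _ , e , Quad-rot (Quad-rot (Quad-rot k)))
    planar′ (inj₂ (inj₁ (refl , refl))) (inj₁ f) k = uncrossed (_ , _ , f , k)
    planar′ (inj₂ (inj₂ (refl , refl))) (inj₁ f) k =
      uncrossed (_ , _ , G.~-sym f , Quad-rot (Quad-rot k))
    planar′ (inj₂ (inj₁ (refl , refl))) (inj₂ (inj₁ (refl , refl))) (k , _) = ≢₁₂ k refl
    planar′ (inj₂ (inj₁ (refl , refl))) (inj₂ (inj₂ (refl , refl))) (k , _) = ≢₂₃ k refl
    planar′ (inj₂ (inj₂ (refl , refl))) (inj₂ (inj₁ (refl , refl))) (k , _) = ≢₂₃ k refl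
    planar′ (inj₂ (inj₂ (refl , refl))) (inj₂ (inj₂ (refl , refl))) (k , _) = ≢₁₂ k refl

  -- A pair, once joined or blocked, stays so when edges are added; therefore a single pass over all
  -- pairs yields a maximal graph.
  Settled : PlaneGraph ω → Fin n × Fin n → Set
  Settled G (a , c) = a ≢ c → _~_ G a c ⊎ Crossed G a c

  Settled-mono : ∀ {G H} → G ⊆ H → ∀ {x} → Settled G x → Settled H x
  Settled-mono sub s a≢c with s a≢c
  ... | inj₁ e               = inj₁ (sub e)
  ... | inj₂ (b , d , e , q) = inj₂ (b , d , sub e , q)

  settle : (G : PlaneGraph ω) (x : Fin n × Fin n) → Σ (PlaneGraph ω) λ H → G ⊆ H × Settled H x
  settle G (a , c) with a ≟ c
  ... | yes a≡c = G , id , λ a≢c → contradiction a≡c a≢c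
  ... | no a≢c with any? (λ b → any? (λ d → PlaneGraph._~?_ G b d ×-dec Quad? a b c d))
  ...   | yes crossed   = G , id , λ _ → inj₂ crossed
  ...   | no  uncrossed with H , sub , e ← addEdge G a≢c uncrossed = H , sub , λ _ → inj₁ e

  settleAll : (G : PlaneGraph ω) (xs : List (Fin n × Fin n)) →
              Σ (PlaneGraph ω) λ H → G ⊆ H × All (Settled H) xs
  settleAll G []       = G , id , []
  settleAll G (x ∷ xs)
    with H , sub , s ← settle G x
    with K , sub′ , ss ← settleAll H xs = K , sub′ ∘ sub , Settled-mono {H} {K} sub′ s ∷ ss

  saturate : (G : PlaneGraph ω) → Σ (PlaneGraph ω) λ H → G ⊆ H × Maximal H
  saturate G with H , sub , s ← settleAll G (cartesianProduct (allFin n) (allFin n)) =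
    H , sub , record { crossed = crossed }
    where
    crossed : ∀ {a c} → a ≢ c → ¬ _~_ H a c → Crossed H a c
    crossed {a} {c} a≢c a≁c
      with All.lookup s (∈-cartesianProduct⁺ (∈-allFin a) (∈-allFin c)) a≢c
    ... | inj₁ e = contradiction e a≁c
    ... | inj₂ k = k

-- The convex hull

third : ∀ {m} (a b : Fin (suc (suc (suc m)))) → ∃ λ c → c ≢ a × c ≢ b
third zero          zero          = 1F , (λ ()) , (λ ())
third zero          (suc zero)    = 2F , (λ ()) , (λ ())
third zero          (suc (suc _)) = 1F , (λ ()) , (λ ())
third (suc zero)    zero          = 2F , (λ ()) , (λ ())
third (suc (suc _)) zero          = 1F , (λ ()) , (λ ())
third (suc _)       (suc _)       = 0F , (λ ()) , (λ ())

module Hull {n : ℕ} (ω : Configuration n) (v₀ : Fin n)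
            (third : ∀ (a b : Fin n) → ∃ λ c → c ≢ a × c ≢ b) where
  open Configuration ω

  -- Hull edges are directed counterclockwise, with every other point on the left; each one thus
  -- occurs once among the ordered pairs.
  HullEdge : Fin n → Fin n → Set
  HullEdge p q = p ≢ q × ∀ r → ¬ O q p r

  HullEdge? : Decidable HullEdge
  HullEdge? p q = ¬? (p ≟ q) ×-dec all? (¬? ∘ O? q p)

  HullEdge-left : ∀ {p q r} → HullEdge p q → r ≢ p → r ≢ q → O p q r
  HullEdge-left (p≢q , h) r≢p r≢q with total p≢q (r≢q ∘ sym) (r≢p ∘ sym)
  ... | inj₁ k = k
  ... | inj₂ k = contradiction k (h _)

  HullEdge-asym : ∀ {p q} → HullEdge p q → ¬ HullEdge q p
  HullEdge-asym {p} {q} h (_ , h′) with r , r≢p , r≢q ← third p q = h′ r (HullEdge-left h r≢p r≢q)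

  leftmost : ∃ λ p → ∀ x → ¬ x < p
  leftmost with p , _ , min ← minimum {P = λ _ → ⊤} (λ _ → yes tt) _<?_ (λ k → <-asym k k)
                                      (λ _ _ _ → <-trans) (v₀ , tt)
    = p , λ x → min x tt

  rightmost : ∃ λ p → ∀ x → ¬ p < x
  rightmost with p , _ , min ← minimum {P = λ _ → ⊤} (λ _ → yes tt) (flip _<?_) (λ k → <-asym k k)
                                       (λ _ _ _ → flip <-trans) (v₀ , tt)
    = p , λ x → min x tt

  leftmost-< : ∀ {p} → (∀ x → ¬ x < p) → ∀ {x} → x ≢ p → p < x
  leftmost-< left x≢p with <-total x≢p
  ... | inj₁ k = contradiction k (left _)
  ... | inj₂ k = k

  -- Gift wrapping from the leftmost point `p`: all others are to its right, so `right-trans` orders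
  -- them by rotation about `p`, and the first of them is `q`.
  hull-start : ∃₂ λ p q → HullEdge p q
  hull-start
    with p , left ← leftmost
    with r , r≢p , _ ← third p p
    with q , q≢p , min ← minimum {P = _≢ p} (¬? ∘ (_≟ p)) (O? p) (λ k → ≢₂₃ k refl)
           (λ x≢p y≢p z≢p → right-trans (leftmost-< left x≢p) (leftmost-< left y≢p)
                                        (leftmost-< left z≢p))
           (r , r≢p)
    = p , q , q≢p ∘ sym , λ r k → min r (≢₂₃ k ∘ sym) (rot k)

  -- The next step of gift wrapping. All other points lie left of `xp`, so the rotation about `p`
  -- orders them linearly.
  hull-next : ∀ {x p} → HullEdge x p → ∃ λ q → HullEdge p q × q ≢ x
  hull-next {x} {p} h
    with r , r≢x , r≢p ← third x p
    with q , (q≢x , q≢p) , min ← minimum {P = λ q → q ≢ x × q ≢ p}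
           (λ q → ¬? (q ≟ x) ×-dec ¬? (q ≟ p)) (O? p) (λ k → ≢₂₃ k refl)
           (λ (a , a′) (b , b′) (c , c′) → cofan-trans (rot (HullEdge-left h a a′))
             (rot (HullEdge-left h b b′)) (rot (HullEdge-left h c c′))) (r , r≢x , r≢p)
    = q , (q≢p ∘ sym , empty) , q≢x
    where
    empty : ∀ r → ¬ O q p r
    empty r k with r ≟ x
    ... | yes refl = asym (HullEdge-left h q≢x q≢p) (rot k)
    ... | no r≢x   = min r (r≢x , ≢₂₃ k ∘ sym) (rot k)

  module _ {G : PlaneGraph ω} (M : Maximal G) where
    open PlaneGraph G using () renaming (_~_ to _≈_; _~?_ to _≈?_)
    open Triangulation M

    -- An edge blocking `pq` would have an end on the empty side of the line.
    HullEdge⇒~ : ∀ {p q} → HullEdge p q → p ≈ q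
    HullEdge⇒~ {p} {q} (p≢q , h) with p ≈? q
    ... | yes e = e
    ... | no ¬e with b , d , _ , k , _ ← Maximal.crossed M p≢q ¬e = contradiction (rot (rot k)) (h b)

    HullEdge⇒¬Triangle : ∀ {p q r} → HullEdge p q → ¬ Triangle q p r
    HullEdge⇒¬Triangle (_ , h) (_ , _ , _ , k , _) = h _ k

-- Double counting of edges and triangles

module EdgeCounting where

  open import Algebra.Properties.CommutativeMonoid.Sum ℕ.+-0-commutativeMonoid
    using (sum; ∑-distrib-+; ∑-comm; sum-cong-≗)
  open import Data.Nat using (_+_; _*_; _≤_)
  open import Data.Nat.Properties
    using (+-assoc; +-comm; +-identityʳ; +-cancelˡ-≤; +-mono-≤; +-monoˡ-≤; +-monoʳ-≤;
           *-zeroʳ; *-distribˡ-+; *-distribʳ-+; *-monoˡ-≤; *-monoʳ-≤;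
           ≤-refl; ≤-reflexive; ≤-trans; m≤m+n; m≤n+m; module ≤-Reasoning)
  open import Data.Nat.Tactic.RingSolver using () renaming (solve-∀ to solve-ℕ)

  sum-mono : ∀ {n} {f g : Fin n → ℕ} → (∀ i → f i ≤ g i) → sum f ≤ sum g
  sum-mono {zero}  h = z≤n
  sum-mono {suc n} h = +-mono-≤ (h zero) (sum-mono (h ∘ suc))

  sum₂ : ∀ {n} → (Fin n → Fin n → ℕ) → ℕ
  sum₂ f = sum λ p → sum (f p)

  sum₃ : ∀ {n} → (Fin n → Fin n → Fin n → ℕ) → ℕ
  sum₃ f = sum λ p → sum₂ (f p)

  sum₂-mono : ∀ {n} {f g : Fin n → Fin n → ℕ} → (∀ p q → f p q ≤ g p q) → sum₂ f ≤ sum₂ g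
  sum₂-mono h = sum-mono λ p → sum-mono (h p)

  sum₃-mono : ∀ {n} {f g : Fin n → Fin n → Fin n → ℕ} → (∀ p q r → f p q r ≤ g p q r) → sum₃ f ≤ sum₃ g
  sum₃-mono h = sum-mono λ p → sum₂-mono (h p)

  sum₂-+ : ∀ {n} (f g : Fin n → Fin n → ℕ) → sum₂ (λ p q → f p q + g p q) ≡ sum₂ f + sum₂ g
  sum₂-+ f g = trans (sum-cong-≗ λ p → ∑-distrib-+ (f p) (g p)) (∑-distrib-+ (sum ∘ f) (sum ∘ g))

  sum₃-+ : ∀ {n} (f g : Fin n → Fin n → Fin n → ℕ) →
           sum₃ (λ p q r → f p q r + g p q r) ≡ sum₃ f + sum₃ g
  sum₃-+ f g = trans (sum-cong-≗ λ p → sum₂-+ (f p) (g p)) (∑-distrib-+ (sum₂ ∘ f) (sum₂ ∘ g))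

  sum₃-rot : ∀ {n} (f : Fin n → Fin n → Fin n → ℕ) → sum₃ f ≡ sum₃ λ p q r → f q r p
  sum₃-rot f = begin
    sum₃ f                                    ≡⟨ sum-cong-≗ (λ p → ∑-comm (f p)) ⟩
    sum₃ (λ p r q → f p q r)                  ≡⟨ ∑-comm (λ p r → sum λ q → f p q r) ⟩
    sum₃ (λ r p q → f p q r)                  ∎
    where open ≡-Reasoning

  sum-*ˡ : ∀ {n} (k : ℕ) (f : Fin n → ℕ) → sum (λ i → k * f i) ≡ k * sum f
  sum-*ˡ {zero}  k f = sym (*-zeroʳ k)
  sum-*ˡ {suc n} k f rewrite sum-*ˡ k (f ∘ suc) = sym (*-distribˡ-+ k (f zero) (sum (f ∘ suc)))

  𝟙 : {A : Set} → Dec A → ℕ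
  𝟙 (yes _) = 1
  𝟙 (no _)  = 0

  𝟙-yes : {A : Set} (d : Dec A) → A → 𝟙 d ≡ 1
  𝟙-yes (yes _) _ = refl
  𝟙-yes (no ¬a) a = contradiction a ¬a

  𝟙-no : {A : Set} (d : Dec A) → ¬ A → 𝟙 d ≡ 0
  𝟙-no (yes a) ¬a = contradiction a ¬a
  𝟙-no (no _)  _  = refl

  𝟙-≥ : {A : Set} (d : Dec A) → A → 1 ≤ 𝟙 d
  𝟙-≥ d a = ≤-reflexive (sym (𝟙-yes d a))

  𝟙-≤ : {A : Set} {k : ℕ} (d : Dec A) → (A → 1 ≤ k) → 𝟙 d ≤ k
  𝟙-≤ (yes a) h = h a
  𝟙-≤ (no _)  h = z≤n

  sum-zero : ∀ {n} {f : Fin n → ℕ} → (∀ i → f i ≡ 0) → sum f ≡ 0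
  sum-zero {zero}  h = refl
  sum-zero {suc n} h rewrite h zero = sum-zero (h ∘ suc)

  term≤sum : ∀ {n} (f : Fin n → ℕ) i → f i ≤ sum f
  term≤sum f zero    = m≤m+n _ _
  term≤sum f (suc i) = ≤-trans (term≤sum (f ∘ suc) i) (m≤n+m _ _)

  sum-unique : ∀ {n} {P : Fin n → Set} {B : Set} (P? : ∀ x → Dec (P x)) (B? : Dec B) →
               (∀ {x y} → P x → P y → x ≡ y) → (∀ {x} → P x → B) → sum (𝟙 ∘ P?) ≤ 𝟙 B?
  sum-unique {zero}  P? B? unique f = z≤n
  sum-unique {suc n} P? B? unique f with P? zero
  ... | yes P0 rewrite 𝟙-yes B? (f P0)
                     | sum-zero (λ i → 𝟙-no (P? (suc i)) λ Pi → 0≢1+n (unique P0 Pi)) = ≤-refl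
  ... | no _ = sum-unique (P? ∘ suc) B? (λ p q → suc-injective (unique p q)) f

  sum-const : ∀ n → sum {n} (λ _ → 1) ≡ n
  sum-const zero    = refl
  sum-const (suc n) = cong suc (sum-const n)

  sum-others : ∀ {n} (i : Fin n) → sum (λ j → 𝟙 (¬? (j ≟ i))) + 1 ≤ n
  sum-others {n} i = begin
    sum (λ j → 𝟙 (¬? (j ≟ i))) + 1                        ≤⟨ +-monoʳ-≤ (sum (λ j → 𝟙 (¬? (j ≟ i)))) one ⟩
    sum (λ j → 𝟙 (¬? (j ≟ i))) + sum (λ j → 𝟙 (j ≟ i))    ≡⟨ ∑-distrib-+ (λ j → 𝟙 (¬? (j ≟ i))) (λ j → 𝟙 (j ≟ i)) ⟨
    sum (λ j → 𝟙 (¬? (j ≟ i)) + 𝟙 (j ≟ i))                ≡⟨ sum-cong-≗ (λ j → split (j ≟ i)) ⟩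
    sum {n} (λ _ → 1)                                     ≡⟨ sum-const n ⟩
    n                                                     ∎
    where
    open ≤-Reasoning
    split : {A : Set} (d : Dec A) → 𝟙 (¬? d) + 𝟙 d ≡ 1
    split (yes _) = refl
    split (no _)  = refl
    one : 1 ≤ sum (λ j → 𝟙 (j ≟ i))
    one = ≤-trans (𝟙-≥ (i ≟ i) refl) (term≤sum (λ j → 𝟙 (j ≟ i)) i)

  𝟙-exclusive₃ : {A B C D : Set} (a : Dec A) (b : Dec B) (c : Dec C) (d : Dec D) →
                 (A → D) → (B → D) → (C → D) → (A → ¬ B) → (B → ¬ C) → (C → ¬ A) →
                 𝟙 a + 𝟙 b + 𝟙 c ≤ 𝟙 d
  𝟙-exclusive₃ (yes a) (yes b) _       d f g h ab bc ca = contradiction b (ab a)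
  𝟙-exclusive₃ (yes a) (no _)  (yes c) d f g h ab bc ca = contradiction a (ca c)
  𝟙-exclusive₃ (yes a) (no _)  (no _)  d f g h ab bc ca = 𝟙-≥ d (f a)
  𝟙-exclusive₃ (no _)  (yes b) (yes c) d f g h ab bc ca = contradiction c (bc b)
  𝟙-exclusive₃ (no _)  (yes b) (no _)  d f g h ab bc ca = 𝟙-≥ d (g b)
  𝟙-exclusive₃ (no _)  (no _)  (yes c) d f g h ab bc ca = 𝟙-≥ d (h c)
  𝟙-exclusive₃ (no _)  (no _)  (no _)  d f g h ab bc ca = z≤n

  weight bichromatic : Bool → Bool → ℕ
  weight      true  true  = 2
  weight      true  false = 1
  weight      false true  = 1
  weight      false false = 2
  bichromatic true  true  = 0
  bichromatic true  false = 1
  bichromatic false true  = 1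
  bichromatic false false = 0

  -- A triangle has zero or two bichromatic sides.
  weight-triangle : ∀ x y z → 4 ≤ weight x y + weight z x + weight y z
  weight-triangle true  true  true  = m≤m+n 4 2
  weight-triangle true  true  false = ≤-refl
  weight-triangle true  false true  = ≤-refl
  weight-triangle true  false false = ≤-refl
  weight-triangle false true  true  = ≤-refl
  weight-triangle false true  false = ≤-refl
  weight-triangle false false true  = ≤-refl
  weight-triangle false false false = m≤m+n 4 2

  weight+bichromatic : ∀ x y → weight x y + bichromatic x y ≡ 2
  weight+bichromatic true  true  = refl
  weight+bichromatic true  false = refl
  weight+bichromatic false true  = refl
  weight+bichromatic false false = refl

  sum₃-*ˡ : ∀ {n} k (f : Fin n → Fin n → Fin n → ℕ) → sum₃ (λ p q r → k * f p q r) ≡ k * sum₃ f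
  sum₃-*ˡ k f = trans
    (sum-cong-≗ λ p → trans (sum-cong-≗ λ q → sum-*ˡ k (f p q)) (sum-*ˡ k (sum ∘ f p)))
    (sum-*ˡ k (sum₂ ∘ f))

  module Counting {n : ℕ} {ω : Configuration n} (v₀ : Fin n)
                  (third : ∀ (a b : Fin n) → ∃ λ c → c ≢ a × c ≢ b)
                  (colour : Fin n → Bool) {G : PlaneGraph ω} (M : Maximal G) where
    open Configuration ω
    open PlaneGraph G
    open Triangulation M
    open Hull ω v₀ third
    open ≤-Reasoning hiding (start)

    w bi adj hull : Fin n → Fin n → ℕ
    w    p q = weight (colour p) (colour q)
    bi   p q = bichromatic (colour p) (colour q)
    adj  p q = 𝟙 (p ~? q)
    hull p q = 𝟙 (HullEdge? p q)

    Starts? : ∀ p q r → Dec (Triangle p q r × p < q × p < r)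
    Starts? p q r = Triangle? p q r ×-dec (p <? q) ×-dec (p <? r)

    Top : Fin n → Fin n → Set
    Top p q = (p ~ q × p < q) × ¬ ∃ λ r → p ~ r × p < r × O p q r

    Over? : ∀ p q → Dec (∃ λ r → p ~ r × p < r × O p q r)
    Over? p q = any? λ r → (p ~? r) ×-dec (p <? r) ×-dec O? p q r

    Top? : ∀ p q → Dec (Top p q)
    Top? p q = ((p ~? q) ×-dec (p <? q)) ×-dec ¬? (Over? p q)

    tri start : Fin n → Fin n → Fin n → ℕ
    tri   p q r = 𝟙 (Triangle? p q r)
    start p q r = 𝟙 (Starts? p q r)

    up top : Fin n → Fin n → ℕ
    up  p q = 𝟙 ((p ~? q) ×-dec (p <? q))
    top p q = 𝟙 (Top? p q)

    -- To the left of a directed edge there is at most one triangle, and none if its reversal is a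
    -- hull edge, as the exterior is then on the left.
    sides : ∀ p q → sum (tri p q) + hull q p ≤ adj p q
    sides p q with HullEdge? q p
    ... | yes h rewrite sum-zero (λ r → 𝟙-no (Triangle? p q r) (HullEdge⇒¬Triangle M h))
                      | 𝟙-yes (p ~? q) (~-sym (HullEdge⇒~ M h)) = ≤-refl
    ... | no _  rewrite +-identityʳ (sum (tri p q)) =
      sum-unique (Triangle? p q) (p ~? q) apex-unique proj₁

    -- A triangle occurs in `tri` in three rotations, but in `start` only with its leftmost vertex
    -- first.
    starts : ∀ p q r → start p q r + start q r p + start r p q ≤ tri p q r
    starts p q r = 𝟙-exclusive₃ (Starts? p q r) (Starts? q r p) (Starts? r p q) (Triangle? p q r)
      proj₁ (Triangle-rot ∘ Triangle-rot ∘ proj₁) (Triangle-rot ∘ proj₁)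
      (λ (_ , pq , _) (_ , _ , qp) → <-asym pq qp)
      (λ (_ , qr , _) (_ , _ , rq) → <-asym qr rq)
      (λ (_ , rp , _) (_ , _ , pr) → <-asym rp pr)

    up-bound : ∀ p q → up p q ≤ top p q + sum (start p q)
    up-bound p q = 𝟙-≤ ((p ~? q) ×-dec (p <? q)) λ (e , l) → either e l (Over? p q)
      where
      either : p ~ q → p < q → Dec (∃ λ r → p ~ r × p < r × O p q r) → 1 ≤ top p q + sum (start p q)
      either e l (no none) = ≤-trans (𝟙-≥ (Top? p q) ((e , l) , none)) (m≤m+n (top p q) (sum (start p q)))
      either e l (yes some) = let r , p<r , t = corner e l some in
        ≤-trans (𝟙-≥ (Starts? p q r) (t , l , p<r))
          (≤-trans (term≤sum (start p q) r) (m≤n+m (sum (start p q)) (top p q)))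

    -- Each vertex has at most one steepest edge to the right, and the rightmost vertex has none.
    top-bound : sum₂ top + 1 ≤ n
    top-bound with R , right ← rightmost = ≤-trans
      (+-monoˡ-≤ 1 (sum-mono λ p →
        sum-unique (Top? p) (¬? (p ≟ R)) (unique p) λ { ((_ , l) , _) refl → right _ l }))
      (sum-others R)
      where
      unique : ∀ p {x y} → Top p x → Top p y → x ≡ y
      unique p {x} {y} ((px , p<x) , nox) ((py , p<y) , noy) with x ≟ y
      ... | yes eq = eq
      ... | no x≢y with total (λ { refl → <-asym p<x p<x }) x≢y (λ { refl → <-asym p<y p<y })
      ...   | inj₁ k = contradiction (y , py , p<y , k) nox
      ...   | inj₂ k = contradiction (x , px , p<x , rot k) noy

    adj-bound : ∀ p q → adj p q ≤ up p q + up q p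
    adj-bound p q = 𝟙-≤ (p ~? q) λ e → either e (<-total λ { refl → ~-irr e })
      where
      either : p ~ q → p < q ⊎ q < p → 1 ≤ up p q + up q p
      either e (inj₁ l) = ≤-trans (𝟙-≥ ((p ~? q) ×-dec (p <? q)) (e , l)) (m≤m+n (up p q) (up q p))
      either e (inj₂ l) = ≤-trans (𝟙-≥ ((q ~? p) ×-dec (q <? p)) (~-sym e , l)) (m≤n+m (up q p) (up p q))

    sides-total : sum₃ (λ p q r → w p q * tri p q r) + sum₂ (λ p q → w p q * hull q p) ≤
                  sum₂ (λ p q → w p q * adj p q)
    sides-total = begin
      sum₃ (λ p q r → w p q * tri p q r) + sum₂ (λ p q → w p q * hull q p)
        ≡⟨ sum₂-+ (λ p q → sum (λ r → w p q * tri p q r)) (λ p q → w p q * hull q p) ⟨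
      sum₂ (λ p q → sum (λ r → w p q * tri p q r) + w p q * hull q p)
        ≤⟨ sum₂-mono (λ p q → ≤-trans (≤-reflexive (factor p q)) (*-monoʳ-≤ (w p q) (sides p q))) ⟩
      sum₂ (λ p q → w p q * adj p q) ∎
      where
      factor : ∀ p q → sum (λ r → w p q * tri p q r) + w p q * hull q p ≡
                       w p q * (sum (tri p q) + hull q p)
      factor p q = trans (cong (_+ w p q * hull q p) (sum-*ˡ (w p q) (tri p q)))
                         (sym (*-distribˡ-+ (w p q) _ _))

    -- The three side weights of a triangle are separated into three sums and reindexed by rotation
    -- until each carries the factor `w p q`; then `starts` merges them into `tri`.
    triangles-total : 4 * sum₃ start ≤ sum₃ (λ p q r → w p q * tri p q r)
    triangles-total = begin
      4 * sum₃ start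
        ≡⟨ sum₃-*ˡ 4 start ⟨
      sum₃ (λ p q r → 4 * start p q r)
        ≤⟨ sum₃-mono (λ p q r → *-monoˡ-≤ (start p q r)
                                  (weight-triangle (colour p) (colour q) (colour r))) ⟩
      sum₃ (λ p q r → (w p q + w r p + w q r) * start p q r)
        ≡⟨ sum₃-cong (λ p q r → expand (w p q) (w r p) (w q r) (start p q r)) ⟩
      sum₃ (λ p q r → f p q r + g p q r + h p q r)
        ≡⟨ sum₃-+₃ f g h ⟩
      sum₃ f + sum₃ g + sum₃ h
        ≡⟨ cong₂ (λ x y → sum₃ f + x + y) (sum₃-rot g) (trans (sum₃-rot h) (sum₃-rot h′)) ⟩
      sum₃ f + sum₃ g″ + sum₃ h″
        ≡⟨ sum₃-+₃ f g″ h″ ⟨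
      sum₃ (λ p q r → f p q r + g″ p q r + h″ p q r)
        ≤⟨ sum₃-mono (λ p q r → ≤-trans
             (≤-reflexive (factor (w p q) (start p q r) (start q r p) (start r p q)))
             (*-monoʳ-≤ (w p q) (starts p q r))) ⟩
      sum₃ (λ p q r → w p q * tri p q r) ∎
      where
      f g h g″ h′ h″ : Fin n → Fin n → Fin n → ℕ
      f  p q r = w p q * start p q r
      g  p q r = w r p * start p q r
      h  p q r = w q r * start p q r
      g″ p q r = w p q * start q r p
      h′ p q r = w r p * start q r p
      h″ p q r = w p q * start r p q
      sum₃-cong : ∀ {f g : Fin n → Fin n → Fin n → ℕ} → (∀ p q r → f p q r ≡ g p q r) → sum₃ f ≡ sum₃ g
      sum₃-cong h = sum-cong-≗ λ p → sum-cong-≗ λ q → sum-cong-≗ (h p q)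
      sum₃-+₃ : ∀ (f g h : Fin n → Fin n → Fin n → ℕ) →
                sum₃ (λ p q r → f p q r + g p q r + h p q r) ≡ sum₃ f + sum₃ g + sum₃ h
      sum₃-+₃ f g h = trans (sum₃-+ (λ p q r → f p q r + g p q r) h) (cong (_+ sum₃ h) (sum₃-+ f g))
      expand : ∀ x y z k → (x + y + z) * k ≡ x * k + y * k + z * k
      expand = solve-ℕ
      factor : ∀ k x y z → k * x + k * y + k * z ≡ k * (x + y + z)
      factor = solve-ℕ

    -- The inequality E ≤ T + n - 1, doubled because `adj` sees every edge in both directions.
    edges-total : sum₂ adj + 2 ≤ (n + sum₃ start) + (n + sum₃ start)
    edges-total = begin
      sum₂ adj + 2                              ≤⟨ +-monoˡ-≤ 2 (sum₂-mono adj-bound) ⟩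
      sum₂ (λ p q → up p q + up q p) + 2        ≡⟨ cong (_+ 2) (sum₂-+ up (λ p q → up q p)) ⟩
      sum₂ up + sum₂ (λ p q → up q p) + 2       ≡⟨ cong (λ x → sum₂ up + x + 2) (∑-comm (λ p q → up q p)) ⟩
      sum₂ up + sum₂ up + 2                     ≡⟨ regroup (sum₂ up) ⟩
      (sum₂ up + 1) + (sum₂ up + 1)             ≤⟨ +-mono-≤ half half ⟩
      (n + sum₃ start) + (n + sum₃ start) ∎
      where
      regroup : ∀ x → x + x + 2 ≡ (x + 1) + (x + 1)
      regroup = solve-ℕ
      swap : ∀ x y → x + y + 1 ≡ (x + 1) + y
      swap = solve-ℕ
      half : sum₂ up + 1 ≤ n + sum₃ start
      half = begin
        sum₂ up + 1                                    ≤⟨ +-monoˡ-≤ 1 (sum₂-mono up-bound) ⟩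
        sum₂ (λ p q → top p q + sum (start p q)) + 1   ≡⟨ cong (_+ 1) (sum₂-+ top (λ p q → sum (start p q))) ⟩
        sum₂ top + sum₃ start + 1                      ≡⟨ swap (sum₂ top) (sum₃ start) ⟩
        (sum₂ top + 1) + sum₃ start                    ≤⟨ +-monoˡ-≤ _ top-bound ⟩
        n + sum₃ start                                 ∎

    weights-total : sum₂ (λ p q → w p q * adj p q) + sum₂ (λ p q → bi p q * adj p q) ≡
                    sum₂ adj + sum₂ adj
    weights-total = trans (sym (sum₂-+ (λ p q → w p q * adj p q) (λ p q → bi p q * adj p q))) (trans
      (sum-cong-≗ λ p → sum-cong-≗ λ q → double (w p q) (bi p q) (adj p q)
                                           (weight+bichromatic (colour p) (colour q)))
      (sum₂-+ adj adj))
      where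
      double : ∀ x y a → x + y ≡ 2 → x * a + y * a ≡ a + a
      double x y a eq = trans (sym (*-distribʳ-+ a x y))
        (trans (cong (_* a) eq) (cong (a +_) (+-identityʳ a)))

    -- Over ordered pairs, `bi` counts every bichromatic edge twice and `hull` every hull edge once,
    -- so this is 2B + H₁ + 2H₂ ≤ 4(n - 1). The term `4 * T` is added to both sides and cancelled.
    bichromatic-bound : sum₂ (λ p q → w p q * hull q p) + sum₂ (λ p q → bi p q * adj p q) + 4 ≤ 4 * n
    bichromatic-bound = +-cancelˡ-≤ (4 * T) _ _ (begin
      4 * T + (H + B + 4)                   ≤⟨ +-monoˡ-≤ (H + B + 4) triangles-total ⟩
      Wt + (H + B + 4)                      ≡⟨ regroup₁ Wt H B ⟩
      Wt + H + B + 4                        ≤⟨ +-monoˡ-≤ 4 (+-monoˡ-≤ B sides-total) ⟩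
      Wa + B + 4                            ≡⟨ cong (_+ 4) weights-total ⟩
      sum₂ adj + sum₂ adj + 4               ≡⟨ regroup₂ (sum₂ adj) ⟩
      (sum₂ adj + 2) + (sum₂ adj + 2)       ≤⟨ +-mono-≤ edges-total edges-total ⟩
      (n + T + (n + T)) + (n + T + (n + T)) ≡⟨ regroup₃ n T ⟩
      4 * T + 4 * n                         ∎)
      where
      T = sum₃ start
      H = sum₂ (λ p q → w p q * hull q p)
      B = sum₂ (λ p q → bi p q * adj p q)
      Wt = sum₃ (λ p q r → w p q * tri p q r)
      Wa = sum₂ (λ p q → w p q * adj p q)
      regroup₁ : ∀ t h b → t + (h + b + 4) ≡ t + h + b + 4
      regroup₁ = solve-ℕ
      regroup₂ : ∀ a → a + a + 4 ≡ (a + 2) + (a + 2)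
      regroup₂ = solve-ℕ
      regroup₃ : ∀ n t → (n + t + (n + t)) + (n + t + (n + t)) ≡ 4 * t + 4 * n
      regroup₃ = solve-ℕ

  module _ {n : ℕ} {ω : Configuration n} (v₀ : Fin n)
           (third : ∀ (a b : Fin n) → ∃ λ c → c ≢ a × c ≢ b) where
    open Configuration ω
    open Hull ω v₀ third

    -- Two consecutive hull edges and the one after them start at three different vertices.
    hull-size : 3 ≤ sum₂ (λ p q → 𝟙 (HullEdge? p q))
    hull-size
      with a , b , ab ← hull-start
      with c , bc , c≢a ← hull-next ab
      with d , cd , _ ← hull-next bc = begin
        1 + 1 + 1
          ≤⟨ +-mono-≤ (+-mono-≤ (one a) (one b)) (one c) ⟩
        sum (λ p → 𝟙 (a ≟ p)) + sum (λ p → 𝟙 (b ≟ p)) + sum (λ p → 𝟙 (c ≟ p))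
          ≡⟨ trans (∑-distrib-+ (λ p → 𝟙 (a ≟ p) + 𝟙 (b ≟ p)) (λ p → 𝟙 (c ≟ p)))
                 (cong (_+ sum (λ p → 𝟙 (c ≟ p))) (∑-distrib-+ (λ p → 𝟙 (a ≟ p)) (λ p → 𝟙 (b ≟ p)))) ⟨
        sum (λ p → 𝟙 (a ≟ p) + 𝟙 (b ≟ p) + 𝟙 (c ≟ p))
          ≤⟨ sum-mono (λ p → ≤-trans (𝟙-exclusive₃ (a ≟ p) (b ≟ p) (c ≟ p) (out? p)
               (λ { refl → b , ab }) (λ { refl → c , bc }) (λ { refl → d , cd })
               (λ { refl refl → proj₁ ab refl }) (λ { refl refl → proj₁ bc refl })
               (λ { refl refl → c≢a refl })) (out-bound p)) ⟩
        sum₂ (λ p q → 𝟙 (HullEdge? p q)) ∎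
      where
      open ≤-Reasoning
      one : ∀ (a : Fin n) → 1 ≤ sum (λ p → 𝟙 (a ≟ p))
      one a = ≤-trans (𝟙-≥ (a ≟ a) refl) (term≤sum (λ p → 𝟙 (a ≟ p)) a)
      out? : ∀ p → Dec (∃ (HullEdge p))
      out? p = any? (HullEdge? p)
      out-bound : ∀ p → 𝟙 (out? p) ≤ sum (λ q → 𝟙 (HullEdge? p q))
      out-bound p with out? p
      ... | no _ = z≤n
      ... | yes (q , h) = ≤-trans (𝟙-≥ (HullEdge? p q) h)
                                  (term≤sum (λ q → 𝟙 (HullEdge? p q)) q)

    module _ (colour : Fin n → Bool) {G₁ G₂ : PlaneGraph ω} (M₁ : Maximal G₁) (M₂ : Maximal G₂)
             (cover : ∀ {p q} → colour p ≢ colour q →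
                      PlaneGraph._~_ G₁ p q ⊎ PlaneGraph._~_ G₂ p q) where
      open PlaneGraph G₁ using () renaming (_~_ to _~₁_; _~?_ to _~₁?_; ~-sym to ~₁-sym)
      open PlaneGraph G₂ using () renaming (_~_ to _~₂_; _~?_ to _~₂?_; ~-sym to ~₂-sym)
      open Counting v₀ third colour M₁ using (w; bi; hull) renaming (adj to adj₁)
      open Counting v₀ third colour M₂ using () renaming (adj to adj₂)
      open Counting {ω = ω} v₀ third colour using (bichromatic-bound)

      -- Bichromatic hull edges are counted twice, since they belong to both triangulations.
      double-cover : ∀ p q → colour p ≢ colour q → 1 + (hull p q + hull q p) ≤ adj₁ p q + adj₂ p q
      double-cover p q p≢q with HullEdge? p q | HullEdge? q p
      ... | yes h | yes h′ = contradiction h′ (HullEdge-asym h)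
      ... | yes h | no _   =
        +-mono-≤ (𝟙-≥ (p ~₁? q) (HullEdge⇒~ M₁ h)) (𝟙-≥ (p ~₂? q) (HullEdge⇒~ M₂ h))
      ... | no _  | yes h  =
        +-mono-≤ (𝟙-≥ (p ~₁? q) (~₁-sym (HullEdge⇒~ M₁ h))) (𝟙-≥ (p ~₂? q) (~₂-sym (HullEdge⇒~ M₂ h)))
      ... | no _  | no _ with cover p≢q
      ...   | inj₁ e = ≤-trans (𝟙-≥ (p ~₁? q) e) (m≤m+n (adj₁ p q) (adj₂ p q))
      ...   | inj₂ e = ≤-trans (𝟙-≥ (p ~₂? q) e) (m≤n+m (adj₂ p q) (adj₁ p q))

      bi-cover : ∀ p q → bi p q + (bi p q * hull p q + bi p q * hull q p) ≤
                         bi p q * adj₁ p q + bi p q * adj₂ p q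
      bi-cover p q = restrict (colour p) (colour q) (hull p q) (hull q p) (adj₁ p q) (adj₂ p q)
                              (double-cover p q)
        where
        identity : ∀ x y → 1 * x + 1 * y ≡ x + y
        identity = solve-ℕ
        restrict : ∀ x y a b c d → (x ≢ y → 1 + (a + b) ≤ c + d) →
                   bichromatic x y + (bichromatic x y * a + bichromatic x y * b) ≤
                   bichromatic x y * c + bichromatic x y * d
        restrict true  true  a b c d h = z≤n
        restrict false false a b c d h = z≤n
        restrict true  false a b c d h rewrite identity a b | identity c d = h λ ()
        restrict false true  a b c d h rewrite identity a b | identity c d = h λ ()

      -- A bichromatic hull edge weighs one less than a monochromatic one in each layer, but its
      -- double covering adds two to `sum₂ bi`, so every hull edge costs four in total. At least
      -- three of them give 12, and the summand 4 of `bichromatic-bound` occurs twice: together 20.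
      two-layer-bound : sum₂ bi + 20 ≤ 8 * n
      two-layer-bound = begin
        Σbi + 20                         ≡⟨ +-assoc Σbi 12 8 ⟨
        Σbi + 12 + 8                     ≤⟨ +-monoˡ-≤ 8 (+-monoʳ-≤ Σbi (*-monoʳ-≤ 4 hull-size)) ⟩
        Σbi + 4 * Σhull + 8              ≡⟨ cong (λ x → Σbi + 4 * x + 8) (∑-comm hull) ⟩
        Σbi + 4 * Σhull′ + 8             ≡⟨ regroup₁ Σbi Σhull′ ⟩
        Σbi + 2 * (Σhull′ + Σhull′) + 8  ≡⟨ cong (λ x → Σbi + 2 * x + 8) weights ⟨
        Σbi + 2 * (H + Bh′) + 8          ≡⟨ regroup₂ Σbi H Bh′ ⟩
        Σbi + (Bh′ + Bh′) + (H + H) + 8  ≡⟨ cong (λ x → Σbi + (x + Bh′) + (H + H) + 8) Bh≡Bh′ ⟨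
        Σbi + (Bh + Bh′) + (H + H) + 8   ≤⟨ +-monoˡ-≤ 8 (+-monoˡ-≤ (H + H) covered) ⟩
        (B₁ + B₂) + (H + H) + 8          ≡⟨ regroup₃ B₁ B₂ H ⟩
        (H + B₁ + 4) + (H + B₂ + 4)      ≤⟨ +-mono-≤ (bichromatic-bound M₁) (bichromatic-bound M₂) ⟩
        4 * n + 4 * n                    ≡⟨ regroup₄ n ⟩
        8 * n                            ∎
        where
        open ≤-Reasoning
        Σbi = sum₂ bi
        Σhull = sum₂ hull
        Σhull′ = sum₂ (λ p q → hull q p)
        H = sum₂ (λ p q → w p q * hull q p)
        Bh = sum₂ (λ p q → bi p q * hull p q)
        Bh′ = sum₂ (λ p q → bi p q * hull q p)
        B₁ = sum₂ (λ p q → bi p q * adj₁ p q)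
        B₂ = sum₂ (λ p q → bi p q * adj₂ p q)
        bichromatic-comm : ∀ x y → bichromatic x y ≡ bichromatic y x
        bichromatic-comm true  true  = refl
        bichromatic-comm true  false = refl
        bichromatic-comm false true  = refl
        bichromatic-comm false false = refl
        Bh≡Bh′ : Bh ≡ Bh′
        Bh≡Bh′ = trans (∑-comm (λ p q → bi p q * hull p q))
          (sum-cong-≗ λ p → sum-cong-≗ λ q →
            cong (_* hull q p) (bichromatic-comm (colour q) (colour p)))
        weights : H + Bh′ ≡ Σhull′ + Σhull′
        weights = trans (sym (sum₂-+ (λ p q → w p q * hull q p) (λ p q → bi p q * hull q p))) (trans
          (sum-cong-≗ λ p → sum-cong-≗ λ q → trans (sym (*-distribʳ-+ (hull q p) (w p q) (bi p q)))
            (trans (cong (_* hull q p) (weight+bichromatic (colour p) (colour q)))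
                   (cong (hull q p +_) (+-identityʳ _))))
          (sum₂-+ (λ p q → hull q p) (λ p q → hull q p)))
        covered : Σbi + (Bh + Bh′) ≤ B₁ + B₂
        covered = begin
          Σbi + (Bh + Bh′)
            ≡⟨ cong (Σbi +_) (sum₂-+ (λ p q → bi p q * hull p q) (λ p q → bi p q * hull q p)) ⟨
          Σbi + sum₂ (λ p q → bi p q * hull p q + bi p q * hull q p)
            ≡⟨ sum₂-+ bi (λ p q → bi p q * hull p q + bi p q * hull q p) ⟨
          sum₂ (λ p q → bi p q + (bi p q * hull p q + bi p q * hull q p))
            ≤⟨ sum₂-mono bi-cover ⟩
          sum₂ (λ p q → bi p q * adj₁ p q + bi p q * adj₂ p q)
            ≡⟨ sum₂-+ (λ p q → bi p q * adj₁ p q) (λ p q → bi p q * adj₂ p q) ⟩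
          B₁ + B₂ ∎
        regroup₁ : ∀ b x → b + 4 * x + 8 ≡ b + 2 * (x + x) + 8
        regroup₁ = solve-ℕ
        regroup₂ : ∀ b x y → b + 2 * (x + y) + 8 ≡ b + (y + y) + (x + x) + 8
        regroup₂ = solve-ℕ
        regroup₃ : ∀ b₁ b₂ h → (b₁ + b₂) + (h + h) + 8 ≡ (h + b₁ + 4) + (h + b₂ + 4)
        regroup₃ = solve-ℕ
        regroup₄ : ∀ n → 4 * n + 4 * n ≡ 8 * n
        regroup₄ = solve-ℕ

open EdgeCounting using (sum₂; bichromatic; two-layer-bound)

-- Rational point sets

open import Data.Rational using (ℚ; 0ℚ; 1ℚ; _+_; _*_; _-_; -_; 1/_; _<_; _≤_; positive; nonNegative)
open import Data.Rational.Properties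
  using (+-*-commutativeRing; +-0-group; +-mono-<; +-mono-≤; +-mono-≤-<; +-monoˡ-<; +-monoˡ-≤; +-monoʳ-≤;
         +-inverseʳ; +-identityˡ; +-identityʳ; +-comm; *-comm; *-assoc; *-identityˡ; *-zeroˡ; *-zeroʳ;
         *-distribˡ-+; *-inverseˡ; *-cancelʳ-<-nonNeg; *-monoʳ-≤-nonNeg; neg-distribˡ-*; neg-distribʳ-*;
         positive⁻¹; pos*pos⇒pos; pos⇒nonNeg; pos⇒nonZero; 1/pos⇒pos; nonNegative⁻¹; nonNeg*nonNeg⇒nonNeg;
         _<?_; <-cmp; <-irrefl; <-asym; <-trans; ≤-<-trans; ≤-refl; ≤-trans; ≤-total; ≤-antisym; <⇒≤; ≮⇒≥)
  renaming (_≟_ to _≟ℚ_)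
open import Algebra.Properties.Group +-0-group using (∙-cancelˡ; x∙y⁻¹≈ε⇒x≈y; x≈y⇒x∙y⁻¹≈ε)

ℚ-ring : AlmostCommutativeRing 0ℓ 0ℓ
ℚ-ring = fromCommutativeRing +-*-commutativeRing λ x → dec⇒maybe (0ℚ ≟ℚ x)

+-pos : ∀ {p q} → 0ℚ < p → 0ℚ < q → 0ℚ < p + q
+-pos = +-mono-<

*-pos : ∀ {p q} → 0ℚ < p → 0ℚ < q → 0ℚ < p * q
*-pos {p} {q} h k = positive⁻¹ (p * q) {{pos*pos⇒pos p {{positive h}} q {{positive k}}}}

*-nonNeg : ∀ {p q} → 0ℚ ≤ p → 0ℚ ≤ q → 0ℚ ≤ p * q
*-nonNeg {p} {q} h k =
  nonNegative⁻¹ (p * q) {{nonNeg*nonNeg⇒nonNeg p {{nonNegative h}} q {{nonNegative k}}}}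

<⇒0< : ∀ {p q} → p < q → 0ℚ < q - p
<⇒0< {p} {q} h = subst (_< q - p) (+-inverseʳ p) (+-monoˡ-< (- p) h)

0<⇒< : ∀ {p q} → 0ℚ < q - p → p < q
0<⇒< {p} {q} h = subst₂ _<_ (+-identityˡ p) (identity q p) (+-monoˡ-< p h)
  where
  identity : ∀ q p → q - p + p ≡ q
  identity = solve-∀ ℚ-ring

0<-cancel : ∀ {p q} → 0ℚ < p * q → 0ℚ < q → 0ℚ < p
0<-cancel {p} {q} h k =
  *-cancelʳ-<-nonNeg q {{pos⇒nonNeg q {{positive k}}}} (subst (_< p * q) (sym (*-zeroˡ q)) h)

abstract
  -- Kept abstract so that orientations do not unfold into rational arithmetic.
  0<?_ : ∀ p → Dec (0ℚ < p)
  0<? p = 0ℚ <? p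

does-0<?0 : does (0<? 0ℚ) ≡ false
does-0<?0 with 0<? 0ℚ
... | yes 0<0 = contradiction 0<0 (<-irrefl refl)
... | no  _   = refl

Sign : Bool → ℚ → Set
Sign true  p = 0ℚ < p
Sign false p = 0ℚ < - p

sign : ∀ {p} → p ≢ 0ℚ → Sign (does (0<? p)) p
sign {p} p≢0 with 0<? p
... | yes 0<p = 0<p
... | no  0≮p with <-cmp 0ℚ p
...   | tri< 0<p _ _ = contradiction 0<p 0≮p
...   | tri≈ _ 0≡p _ = contradiction (sym 0≡p) p≢0
...   | tri> _ _ p<0 = subst (0ℚ <_) (+-identityˡ (- p)) (<⇒0< p<0)

sign-* : ∀ {p q} b c → Sign b p → Sign c q → Sign (not (b xor c)) (p * q)
sign-* true  true  h k = *-pos h k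
sign-* {p} {q} true  false h k = subst (0ℚ <_) (sym (neg-distribʳ-* p q)) (*-pos h k)
sign-* {p} {q} false true  h k = subst (0ℚ <_) (sym (neg-distribˡ-* p q)) (*-pos h k)
sign-* {p} {q} false false h k = subst (0ℚ <_) (identity p q) (*-pos h k)
  where
  identity : ∀ p q → (- p) * (- q) ≡ p * q
  identity = solve-∀ ℚ-ring

0≮0 : ∀ {p} → 0ℚ < p → p ≢ 0ℚ
0≮0 h refl = <-irrefl refl h

-- In the two excluded patterns all four terms of the relation have the same sign and cannot add up
-- to zero.
acyclic-sign : ∀ {p q r s} a b c d → Sign a p → Sign b q → Sign c r → Sign d s →
               p - q + r - s ≡ 0ℚ → acyclic₄ a b c d ≡ true
acyclic-sign true  true  _     _     _ _ _ _ _ = refl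
acyclic-sign true  false false _     _ _ _ _ _ = refl
acyclic-sign true  false true  true  _ _ _ _ _ = refl
acyclic-sign true  false true  false h i j k eq = contradiction eq (0≮0 (+-pos (+-pos (+-pos h i) j) k))
acyclic-sign false false _     _     _ _ _ _ _ = refl
acyclic-sign false true  true  _     _ _ _ _ _ = refl
acyclic-sign false true  false false _ _ _ _ _ = refl
acyclic-sign {p} {q} {r} {s} false true false true h i j k eq =
  contradiction (trans (identity p q r s) (cong -_ eq)) (0≮0 (+-pos (+-pos (+-pos h i) j) k))
  where
  identity : ∀ p q r s → (- p) + q + (- r) + s ≡ - (p - q + r - s)
  identity = solve-∀ ℚ-ring

-- Here `x`, `y`, `z` are true when the respective product is negative, which is the form delivered
-- by `sign-*`.
plücker-sign : ∀ {p q r} x y z → Sign (not x) p → Sign (not y) q → Sign (not z) r →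
               p - q + r ≡ 0ℚ → (x xor not y) ∨ (x xor z) ≡ true
plücker-sign true  true  _     _ _ _ _ = refl
plücker-sign true  false false _ _ _ _ = refl
plücker-sign {p} {q} {r} true false true h i j eq =
  contradiction (trans (identity p q r) (cong -_ eq)) (0≮0 (+-pos (+-pos h i) j))
  where
  identity : ∀ p q r → (- p) + q + (- r) ≡ - (p - q + r)
  identity = solve-∀ ℚ-ring
plücker-sign false false _     _ _ _ _ = refl
plücker-sign false true  true  _ _ _ _ = refl
plücker-sign false true  false h i j eq = contradiction eq (0≮0 (+-pos (+-pos h i) j))

-- Orientation determinants of points in general position

module GeneralPosition {n : ℕ} (X Y : Fin n → ℚ) where

  det : Fin n → Fin n → Fin n → ℚ
  det a b c = (X b - X a) * (Y c - Y a) - (X c - X a) * (Y b - Y a)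

  module _ (X-injective : ∀ {a b} → X a ≡ X b → a ≡ b)
           (det≢0 : ∀ {a b c} → a ≢ b → b ≢ c → a ≢ c → det a b c ≢ 0ℚ) where

    ccw : Fin n → Fin n → Fin n → Bool
    ccw a b c = does (0<? det a b c)

    det-rotate : ∀ a b c → det a b c ≡ det b c a
    det-rotate a b c = identity (X a) (Y a) (X b) (Y b) (X c) (Y c)
      where
      identity : ∀ a a′ b b′ c c′ → (b - a) * (c′ - a′) - (c - a) * (b′ - a′) ≡
                                    (c - b) * (a′ - b′) - (a - b) * (c′ - b′)
      identity = solve-∀ ℚ-ring

    det-reverse : ∀ a b c → det b a c ≡ - det a b c
    det-reverse a b c = identity (X a) (Y a) (X b) (Y b) (X c) (Y c)
      where
      identity : ∀ a a′ b b′ c c′ → (a - b) * (c′ - b′) - (c - b) * (a′ - b′) ≡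
                                    - ((b - a) * (c′ - a′) - (c - a) * (b′ - a′))
      identity = solve-∀ ℚ-ring

    det-degenerate : ∀ a b → det a a b ≡ 0ℚ
    det-degenerate a b = identity (X a) (Y a) (X b) (Y b)
      where
      identity : ∀ a a′ b b′ → (a - a) * (b′ - a′) - (b - a) * (a′ - a′) ≡ 0ℚ
      identity = solve-∀ ℚ-ring

    det-acyclic : ∀ a b c d → det a b c - det a b d + det a c d - det b c d ≡ 0ℚ
    det-acyclic a b c d = identity (X a) (Y a) (X b) (Y b) (X c) (Y c) (X d) (Y d)
      where
      identity : ∀ a a′ b b′ c c′ d d′ →
        ((b - a) * (c′ - a′) - (c - a) * (b′ - a′)) - ((b - a) * (d′ - a′) - (d - a) * (b′ - a′)) +
        ((c - a) * (d′ - a′) - (d - a) * (c′ - a′)) - ((c - b) * (d′ - b′) - (d - b) * (c′ - b′)) ≡ 0ℚ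
      identity = solve-∀ ℚ-ring

    det-plücker : ∀ t s p q r →
      det t s p * det t q r - det t s q * det t p r + det t s r * det t p q ≡ 0ℚ
    det-plücker t s p q r =
      identity (X s - X t) (Y s - Y t) (X p - X t) (Y p - Y t)
               (X q - X t) (Y q - Y t) (X r - X t) (Y r - Y t)
      where
      identity : ∀ s s′ p p′ q q′ r r′ →
        (s * p′ - p * s′) * (q * r′ - r * q′) - (s * q′ - q * s′) * (p * r′ - r * p′) +
        (s * r′ - r * s′) * (p * q′ - q * p′) ≡ 0ℚ
      identity = solve-∀ ℚ-ring

    -- The Plücker relation about `v` with the vertical direction as fourth vector: `X p - X v` is
    -- the determinant of `p - v` and the vertical unit vector.
    det-sweep : ∀ v a b c →
      (X b - X v) * det v a c ≡ (X c - X v) * det v a b + (X a - X v) * det v b c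
    det-sweep v a b c =
      identity (X a - X v) (Y a - Y v) (X b - X v) (Y b - Y v) (X c - X v) (Y c - Y v)
      where
      identity : ∀ a a′ b b′ c c′ →
        b * (a * c′ - c * a′) ≡ c * (a * b′ - b * a′) + a * (b * c′ - c * b′)
      identity = solve-∀ ℚ-ring

    sign-ccw : ∀ {a b c} → a ≢ b → b ≢ c → a ≢ c → Sign (ccw a b c) (det a b c)
    sign-ccw p q r = sign (det≢0 p q r)

    ccw⇒0< : ∀ {a b c} → ccw a b c ≡ true → 0ℚ < det a b c
    ccw⇒0< {a} {b} {c} eq with 0<? det a b c
    ... | yes h = h

    0<⇒ccw : ∀ {a b c} → 0ℚ < det a b c → ccw a b c ≡ true
    0<⇒ccw {a} {b} {c} h with 0<? det a b c
    ... | yes _ = refl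
    ... | no ¬h = contradiction h ¬h

    sign-unique : ∀ b c {p} → Sign b p → Sign c (- p) → b ≡ not c
    sign-unique true  true  {p} h k = contradiction refl (0≮0 (subst (0ℚ <_) (+-inverseʳ p) (+-pos h k)))
    sign-unique true  false _ _ = refl
    sign-unique false true  _ _ = refl
    sign-unique false false {p} h k = contradiction refl (0≮0 (subst (0ℚ <_) (+-inverseʳ (- p)) (+-pos h k)))

    chirotope : Chirotope (Fin n)
    chirotope = record
      { ccw        = ccw
      ; degenerate = λ a b → trans (cong (λ d → does (0<? d)) (det-degenerate a b)) does-0<?0
      ; rotate     = λ a b c → cong (λ d → does (0<? d)) (det-rotate a b c)
      ; reverse    = λ { {a} {b} {c} ((ab ∷ ac ∷ []) ∷ (bc ∷ []) ∷ [] ∷ []) →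
          sign-unique _ _ (sign-ccw (ab ∘ sym) ac bc)
            (subst (Sign (ccw a b c)) (det-reverse b a c) (sign-ccw ab bc ac)) }
      ; acyclic    = λ { {a} {b} {c} {d} ((ab ∷ ac ∷ ad ∷ []) ∷ (bc ∷ bd ∷ []) ∷ (cd ∷ []) ∷ [] ∷ []) →
          acyclic-sign _ _ _ _ (sign-ccw ab bc ac) (sign-ccw ab bd ad) (sign-ccw ac cd ad)
            (sign-ccw bc cd bd) (det-acyclic a b c d) }
      ; plücker    = λ { {t} {s} {p} {q} {r}
          ((ts ∷ tp ∷ tq ∷ tr ∷ []) ∷ (sp ∷ sq ∷ sr ∷ []) ∷ (pq ∷ pr ∷ []) ∷ (qr ∷ []) ∷ [] ∷ []) →
          plücker-sign (ccw t s p xor ccw t q r) (ccw t s q xor ccw t p r) (ccw t s r xor ccw t p q)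
            (sign-* (ccw t s p) (ccw t q r) (sign-ccw ts sp tp) (sign-ccw tq qr tr))
            (sign-* (ccw t s q) (ccw t p r) (sign-ccw ts sq tq) (sign-ccw tp pr tr))
            (sign-* (ccw t s r) (ccw t p q) (sign-ccw ts sr tr) (sign-ccw tp pq tq))
            (det-plücker t s p q r) }
      }

    configuration : Configuration n
    configuration = record
      { chirotope   = chirotope
      ; _<_         = λ a b → X a < X b
      ; _<?_        = λ a b → X a <? X b
      ; <-asym      = <-asym
      ; <-trans     = <-trans
      ; <-total     = connex
      ; right-trans = λ {v} {a} {b} {c} va vb vc ab bc → 0<⇒ccw (0<-cancel
          (subst (0ℚ <_) (trans (sym (det-sweep v a b c)) (*-comm _ (det v a c)))
            (+-pos (*-pos (<⇒0< vc) (ccw⇒0< ab)) (*-pos (<⇒0< va) (ccw⇒0< bc))))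
          (<⇒0< vb))
      ; wedge       = λ {v} {a} {c} {b} va vc ac ab bc → 0<⇒< (0<-cancel
          (subst (0ℚ <_) (sym (det-sweep v a b c))
            (+-pos (*-pos (<⇒0< vc) (ccw⇒0< ab)) (*-pos (<⇒0< va) (ccw⇒0< bc))))
          (ccw⇒0< ac))
      }
      where
      connex : ∀ {a b} → a ≢ b → X a < X b ⊎ X b < X a
      connex {a} {b} a≢b with <-cmp (X a) (X b)
      ... | tri< h _ _ = inj₁ h
      ... | tri≈ _ h _ = contradiction (X-injective h) a≢b
      ... | tri> _ _ h = inj₂ h

≤⇒0≤ : ∀ {p q} → p ≤ q → 0ℚ ≤ q - p
≤⇒0≤ {p} {q} h = subst (_≤ q - p) (+-inverseʳ p) (+-monoˡ-≤ (- p) h)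

inverse : ∀ {k} → 0ℚ < k → ∃ λ i → 0ℚ < i × i * k ≡ 1ℚ
inverse {k} h = 1/ k , positive⁻¹ (1/ k) {{1/pos⇒pos k}} , *-inverseˡ k
  where instance
    _ = positive h
    _ = pos⇒nonZero k

0<1 : 0ℚ < 1ℚ
0<1 = positive⁻¹ 1ℚ

-- Perturbations by sufficiently small amounts

Small : (ℚ → Set) → Set
Small P = ∃ λ ε → 0ℚ < ε × ∀ η → 0ℚ < η → η ≤ ε → P η

abstract
  Small-all : ∀ {n} {P : Fin n → ℚ → Set} → (∀ i → Small (P i)) → Small (λ η → ∀ i → P i η)
  Small-all {zero}  h = 1ℚ , 0<1 , λ _ _ _ ()
  Small-all {suc n} h with h zero | Small-all (h ∘ suc)
  ... | ε , 0<ε , f | δ , 0<δ , g with ≤-total ε δ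
  ...   | inj₁ ε≤δ = ε , 0<ε , λ { η 0<η η≤ε zero    → f η 0<η η≤ε
                                ; η 0<η η≤ε (suc i) → g η 0<η (≤-trans η≤ε ε≤δ) i }
  ...   | inj₂ δ≤ε = δ , 0<δ , λ { η 0<η η≤δ zero    → f η 0<η (≤-trans η≤δ δ≤ε)
                                ; η 0<η η≤δ (suc i) → g η 0<η η≤δ i }

Small-positive : ∀ {d} v → 0ℚ < d → Small λ η → 0ℚ < d + η * v
Small-positive {d} v 0<d with <-cmp v 0ℚ
... | tri≈ _ refl _ = 1ℚ , 0<1 , λ η _ _ → subst (0ℚ <_) (identity d η) 0<d
  where
  identity : ∀ d η → d ≡ d + η * 0ℚ
  identity d η = trans (sym (+-identityʳ d)) (cong (d +_) (sym (*-zeroʳ η)))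
... | tri> _ _ 0<v = 1ℚ , 0<1 , λ η 0<η _ → +-pos 0<d (*-pos 0<η 0<v)
... | tri< v<0 _ _ with i , 0<i , ik≡1 ← inverse (+-pos 0<d (<⇒0< v<0)) =
  -- The threshold is `d / (d - v)`; up to it, `d + η * v` is at least `d * η`.
  i * d , *-pos 0<i 0<d , λ η 0<η η≤id →
    subst (0ℚ <_) (identity d v η) (+-mono-≤-< (≤⇒0≤ (bound η η≤id)) (*-pos 0<d 0<η))
  where
  k = d + (0ℚ - v)
  identity : ∀ d v η → (d - η * (d + (0ℚ - v))) + d * η ≡ d + η * v
  identity = solve-∀ ℚ-ring
  bound : ∀ η → η ≤ i * d → η * k ≤ d
  bound η h = subst (η * k ≤_) (trans (rearrange i d k) (trans (cong (_* d) ik≡1) (*-identityˡ d)))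
    (*-monoʳ-≤-nonNeg k {{nonNegative (<⇒≤ (+-pos 0<d (<⇒0< v<0)))}} h)
    where
    rearrange : ∀ i d k → i * d * k ≡ i * k * d
    rearrange = solve-∀ ℚ-ring

Sign⇒≢0 : ∀ b {p} → Sign b p → p ≢ 0ℚ
Sign⇒≢0 true  h    = 0≮0 h
Sign⇒≢0 false h eq = 0≮0 h (cong -_ eq)

abstract
  Small-sign : ∀ d v → Small λ η → ∀ b → Sign b d → Sign b (d + η * v)
  Small-sign d v with <-cmp 0ℚ d
  ... | tri≈ _ refl _ = 1ℚ , 0<1 , λ η _ _ b s → contradiction refl (Sign⇒≢0 b s)
  ... | tri< 0<d _ _ with ε , 0<ε , f ← Small-positive v 0<d =
    ε , 0<ε , λ { η h k true _ → f η h k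
                ; η h k false s → contradiction (+-inverseʳ d) (0≮0 (+-pos 0<d s)) }
  ... | tri> _ _ d<0 with ε , 0<ε , f ← Small-positive (- v) (subst (0ℚ <_) (+-identityˡ (- d)) (<⇒0< d<0)) =
    ε , 0<ε , λ { η h k true s → contradiction s (<-asym d<0)
                ; η h k false _ → subst (0ℚ <_) (identity d v η) (f η h k) }
    where
    identity : ∀ d v η → (- d) + η * (- v) ≡ - (d + η * v)
    identity = solve-∀ ℚ-ring

≢0-* : ∀ {p q} → p ≢ 0ℚ → q ≢ 0ℚ → p * q ≢ 0ℚ
≢0-* {p} {q} h k = Sign⇒≢0 _ (sign-* (does (0<? p)) (does (0<? q)) (sign h) (sign k))

-- The point dividing ab in the ratio m : l, with denominators cleared.
onSegment : ∀ {l m p₁ p₂ a₁ a₂ b₁ b₂} → 0ℚ < l + m → 0ℚ ≤ l → 0ℚ ≤ m →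
            (l + m) * p₁ ≡ l * a₁ + m * b₁ → (l + m) * p₂ ≡ l * a₂ + m * b₂ →
            OnSegment (p₁ , p₂) (a₁ , a₂) (b₁ , b₂)
onSegment {l} {m} 0<k 0≤l 0≤m e₁ e₂ with i , 0<i , ik≡1 ← inverse 0<k =
  i * m , *-nonNeg (<⇒≤ 0<i) 0≤m ,
  subst₂ _≤_ (+-identityˡ (i * m)) (trans (sym (*-distribˡ-+ i l m)) ik≡1)
    (+-monoˡ-≤ (i * m) (*-nonNeg (<⇒≤ 0<i) 0≤l)) ,
  coordinate e₁ , coordinate e₂
  where
  expand : ∀ i l m a b → i * (l * a + m * b) ≡ (i * (l + m) - i * m) * a + i * m * b
  expand = solve-∀ ℚ-ring
  coordinate : ∀ {p a b} → (l + m) * p ≡ l * a + m * b → p ≡ (1ℚ - i * m) * a + i * m * b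
  coordinate {p} {a} {b} e = begin
    p                                        ≡⟨ *-identityˡ p ⟨
    1ℚ * p                                   ≡⟨ cong (_* p) ik≡1 ⟨
    i * (l + m) * p                          ≡⟨ *-assoc i (l + m) p ⟩
    i * ((l + m) * p)                        ≡⟨ cong (i *_) e ⟩
    i * (l * a + m * b)                      ≡⟨ expand i l m a b ⟩
    (i * (l + m) - i * m) * a + i * m * b    ≡⟨ cong (λ x → (x - i * m) * a + i * m * b) ik≡1 ⟩
    (1ℚ - i * m) * a + i * m * b             ∎
    where open ≡-Reasoning

segment-sym : ∀ {p a b} → OnSegment p a b → OnSegment p b a
segment-sym {_} {a₁ , a₂} {b₁ , b₂} (t , 0≤t , t≤1 , e₁ , e₂) =
  1ℚ - t , ≤⇒0≤ t≤1 , subst₂ _≤_ (+-identityʳ _) (cancel t) (+-monoʳ-≤ (1ℚ - t) 0≤t) ,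
  trans e₁ (swap t a₁ b₁) , trans e₂ (swap t a₂ b₂)
  where
  cancel : ∀ t → 1ℚ - t + t ≡ 1ℚ
  cancel = solve-∀ ℚ-ring
  swap : ∀ t a b → (1ℚ - t) * a + t * b ≡ (1ℚ - (1ℚ - t)) * b + (1ℚ - t) * a
  swap = solve-∀ ℚ-ring

segment-start : ∀ a b → OnSegment a a b
segment-start (a₁ , a₂) (b₁ , b₂) = 0ℚ , ≤-refl , <⇒≤ 0<1 , identity a₁ b₁ , identity a₂ b₂
  where
  identity : ∀ a b → a ≡ (1ℚ - 0ℚ) * a + 0ℚ * b
  identity = solve-∀ ℚ-ring

+-zeroˡ : ∀ {p q} → 0ℚ ≤ p → 0ℚ ≤ q → p + q ≡ 0ℚ → p ≡ 0ℚ
+-zeroˡ {p} {q} 0≤p 0≤q e =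
  ≤-antisym (subst₂ _≤_ (+-identityʳ p) e (+-monoʳ-≤ p 0≤q)) 0≤p

0<-factor : ∀ {u v} → 0ℚ < u * v → 0ℚ < u + v → 0ℚ < u
0<-factor {u} {v} h k with <-cmp 0ℚ u
... | tri< 0<u _ _ = 0<u
... | tri≈ _ refl _ = contradiction (*-zeroˡ v) (0≮0 h)
... | tri> _ _ u<0 =
  contradiction (cancel u v) (0≮0 (+-pos h (*-pos (<⇒0< u<0) (subst (0ℚ <_) (isolate u v) (+-pos k (<⇒0< u<0))))))
  where
  isolate : ∀ u v → (u + v) + (0ℚ - u) ≡ v
  isolate = solve-∀ ℚ-ring
  cancel : ∀ u v → u * v + (0ℚ - u) * v ≡ 0ℚ
  cancel = solve-∀ ℚ-ring

module Perturbation {n : ℕ} (X Y : Fin n → ℚ) where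

  open GeneralPosition X Y using (det)

  -- The orientation determinant of the points of the parabola above the three abscissae; it
  -- vanishes only if two abscissae agree.
  vandermonde : Fin n → Fin n → Fin n → ℚ
  vandermonde a b c = (X b - X a) * (X c - X a) * (X c - X b)

  module _ (ε : ℚ) where

    -- Bending the plane along a parabola removes collinear triples.
    Y′ : Fin n → ℚ
    Y′ a = Y a + ε * (X a * X a)

    open GeneralPosition X Y′ using () renaming (det to det′)

    det-perturb : ∀ a b c → det′ a b c ≡ det a b c + ε * vandermonde a b c
    det-perturb a b c = identity ε (X a) (Y a) (X b) (Y b) (X c) (Y c)
      where
      identity : ∀ ε a a′ b b′ c c′ →
        (b - a) * ((c′ + ε * (c * c)) - (a′ + ε * (a * a))) -
        (c - a) * ((b′ + ε * (b * b)) - (a′ + ε * (a * a))) ≡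
        ((b - a) * (c′ - a′) - (c - a) * (b′ - a′)) + ε * ((b - a) * (c - a) * (c - b))
      identity = solve-∀ ℚ-ring

    -- Nonzero orientations survive the bend. A collinear triple has no sign to preserve and takes
    -- that of its Vandermonde product.
    Faithful : Set
    Faithful = ∀ a b c s → Sign s (det a b c) → Sign s (det a b c + ε * vandermonde a b c)

    module _ (0<ε : 0ℚ < ε) (X-injective : ∀ {a b} → X a ≡ X b → a ≡ b) (faithful : Faithful) where

      det′≢0 : ∀ {a b c} → a ≢ b → b ≢ c → a ≢ c → det′ a b c ≢ 0ℚ
      det′≢0 {a} {b} {c} a≢b b≢c a≢c eq with det a b c ≟ℚ 0ℚ
      ... | no d≢0  = Sign⇒≢0 _ (faithful a b c _ (sign d≢0)) (trans (sym (det-perturb a b c)) eq)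
      ... | yes d≡0 =
        ≢0-* (0≮0 0<ε) (≢0-* (≢0-* (apart a≢b) (apart a≢c)) (apart b≢c)) (begin
          ε * vandermonde a b c             ≡⟨ +-identityˡ _ ⟨
          0ℚ + ε * vandermonde a b c        ≡⟨ cong (_+ ε * vandermonde a b c) d≡0 ⟨
          det a b c + ε * vandermonde a b c ≡⟨ det-perturb a b c ⟨
          det′ a b c                        ≡⟨ eq ⟩
          0ℚ                                ∎)
        where
        open ≡-Reasoning
        cancel : ∀ p q → q ≡ (q - p) + p
        cancel = solve-∀ ℚ-ring
        apart : ∀ {a b} → a ≢ b → X b - X a ≢ 0ℚ
        apart {a} {b} a≢b e = a≢b (X-injective (sym
          (trans (cancel (X a) (X b)) (trans (cong (_+ X a) e) (+-identityˡ (X a))))))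

      configuration′ : Configuration n
      configuration′ = GeneralPosition.configuration X Y′ X-injective det′≢0

      private
        P : Fin n → Point
        P a = X a , Y a

      det-nonNeg : ∀ a b c → 0ℚ < det′ a b c → 0ℚ ≤ det a b c
      det-nonNeg a b c h = ≮⇒≥ λ d<0 →
        0≮0 (+-pos (subst (0ℚ <_) (det-perturb a b c) h)
                   (faithful a b c false (subst (0ℚ <_) (+-identityˡ _) (<⇒0< d<0))))
            (+-inverseʳ (det a b c + ε * vandermonde a b c))

      collinear⇒vandermonde : ∀ a b c → 0ℚ < det′ a b c → det a b c ≡ 0ℚ → 0ℚ < vandermonde a b c
      collinear⇒vandermonde a b c h d≡0 = 0<-cancel (subst (0ℚ <_) (begin
        det′ a b c                          ≡⟨ det-perturb a b c ⟩
        det a b c + ε * vandermonde a b c   ≡⟨ cong (_+ ε * vandermonde a b c) d≡0 ⟩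
        0ℚ + ε * vandermonde a b c          ≡⟨ +-identityˡ _ ⟩
        ε * vandermonde a b c               ≡⟨ *-comm ε _ ⟩
        vandermonde a b c * ε               ∎) h) 0<ε
        where open ≡-Reasoning

      -- As `X c - X a` is positive, so is the product of `X c - X b` and `X b - X a`; their sum is
      -- positive too, hence both are, and they are the weights of `a` and `c` in `b`.
      between : ∀ a b c → X a < X c → det a b c ≡ 0ℚ → 0ℚ < vandermonde a b c →
                OnSegment (P b) (P a) (P c)
      between a b c a<c d≡0 v = onSegment {l = X c - X b} {m = X b - X a}
        (subst (0ℚ <_) (total (X a) (X b) (X c)) 0<c-a)
        (<⇒≤ (0<-factor cb*ba (subst (0ℚ <_) (total (X a) (X b) (X c)) 0<c-a)))
        (<⇒≤ (0<-factor (subst (0ℚ <_) (*-comm (X c - X b) (X b - X a)) cb*ba)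
                        (subst (0ℚ <_) (total′ (X a) (X b) (X c)) 0<c-a)))
        (identity (X a) (X b) (X c))
        (trans (identity′ (X a) (Y a) (X b) (Y b) (X c) (Y c))
          (trans (cong (λ x → combination - x) d≡0) (+-identityʳ combination)))
        where
        0<c-a = <⇒0< a<c
        combination = (X c - X b) * Y a + (X b - X a) * Y c
        total : ∀ a b c → c - a ≡ (c - b) + (b - a)
        total = solve-∀ ℚ-ring
        total′ : ∀ a b c → c - a ≡ (b - a) + (c - b)
        total′ = solve-∀ ℚ-ring
        rearrange : ∀ x y z → x * y * z ≡ z * x * y
        rearrange = solve-∀ ℚ-ring
        cb*ba : 0ℚ < (X c - X b) * (X b - X a)
        cb*ba = 0<-cancel (subst (0ℚ <_) (rearrange (X b - X a) (X c - X a) (X c - X b)) v) 0<c-a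
        identity : ∀ a b c → ((c - b) + (b - a)) * b ≡ (c - b) * a + (b - a) * c
        identity = solve-∀ ℚ-ring
        identity′ : ∀ a a′ b b′ c c′ → ((c - b) + (b - a)) * b′ ≡
          ((c - b) * a′ + (b - a) * c′) - ((b - a) * (c′ - a′) - (c - a) * (b′ - a′))
        identity′ = solve-∀ ℚ-ring

      -- In the original plane the four orientations are still nonnegative, and either pair of
      -- opposite ones adds up to twice the area. If the area is positive, dividing the affine
      -- dependence of `a`, `b`, `c`, `d` by it expresses one point on both diagonals. If it is
      -- zero, the points are collinear and the sense of the bend puts `b` or `d` on the segment
      -- `ac`.
      Quad⇒meet : ∀ a b c d → 0ℚ < det′ a b c → 0ℚ < det′ b c d → 0ℚ < det′ c d a → 0ℚ < det′ d a b →
                  ∃ λ p → OnSegment p (P a) (P c) × OnSegment p (P b) (P d)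
      Quad⇒meet a b c d h₁ h₂ h₃ h₄ = meet (<-cmp 0ℚ (det c d a + det a b c))
        where
        0≤abc = det-nonNeg a b c h₁
        0≤bcd = det-nonNeg b c d h₂
        0≤cda = det-nonNeg c d a h₃
        0≤dab = det-nonNeg d a b h₄
        area : ∀ a a′ b b′ c c′ d d′ →
          ((d - c) * (a′ - c′) - (a - c) * (d′ - c′)) + ((b - a) * (c′ - a′) - (c - a) * (b′ - a′)) ≡
          ((c - b) * (d′ - b′) - (d - b) * (c′ - b′)) + ((a - d) * (b′ - d′) - (b - d) * (a′ - d′))
        area = solve-∀ ℚ-ring
        crossing₁ : ∀ a a′ b b′ c c′ d d′ →
          ((c - b) * (d′ - b′) - (d - b) * (c′ - b′)) * a + ((a - d) * (b′ - d′) - (b - d) * (a′ - d′)) * c ≡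
          ((d - c) * (a′ - c′) - (a - c) * (d′ - c′)) * b + ((b - a) * (c′ - a′) - (c - a) * (b′ - a′)) * d
        crossing₁ = solve-∀ ℚ-ring
        crossing₂ : ∀ a a′ b b′ c c′ d d′ →
          ((c - b) * (d′ - b′) - (d - b) * (c′ - b′)) * a′ + ((a - d) * (b′ - d′) - (b - d) * (a′ - d′)) * c′ ≡
          ((d - c) * (a′ - c′) - (a - c) * (d′ - c′)) * b′ + ((b - a) * (c′ - a′) - (c - a) * (b′ - a′)) * d′
        crossing₂ = solve-∀ ℚ-ring
        areas : det c d a + det a b c ≡ det b c d + det d a b
        areas = area (X a) (Y a) (X b) (Y b) (X c) (Y c) (X d) (Y d)
        flat : Tri (X a < X c) (X a ≡ X c) (X c < X a) → det a b c ≡ 0ℚ → det c d a ≡ 0ℚ →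
               ∃ λ p → OnSegment p (P a) (P c) × OnSegment p (P b) (P d)
        flat (tri< a<c _ _) e _ =
          P b , between a b c a<c e (collinear⇒vandermonde a b c h₁ e) , segment-start (P b) (P d)
        flat (tri≈ _ a≡c _) e _ = contradiction
          (coincide (X a) (X b) (X c) a≡c) (0≮0 (collinear⇒vandermonde a b c h₁ e))
          where
          coincide : ∀ x y z → x ≡ z → (y - x) * (z - x) * (z - y) ≡ 0ℚ
          coincide x y .x refl = vanish x y
            where
            vanish : ∀ x y → (y - x) * (x - x) * (x - y) ≡ 0ℚ
            vanish = solve-∀ ℚ-ring
        flat (tri> _ _ c<a) _ e =
          P d , segment-sym (between c d a c<a e (collinear⇒vandermonde c d a h₃ e)) ,
          segment-sym (segment-start (P d) (P b))
        meet : Tri (0ℚ < det c d a + det a b c) (0ℚ ≡ det c d a + det a b c) (det c d a + det a b c < 0ℚ) →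
               ∃ λ p → OnSegment p (P a) (P c) × OnSegment p (P b) (P d)
        meet (tri> _ _ neg) = contradiction neg (λ h → <-irrefl refl (≤-<-trans (+-mono-≤ 0≤cda 0≤abc) h))
        meet (tri≈ _ e _) =
          flat (<-cmp (X a) (X c)) (+-zeroˡ 0≤abc 0≤cda (trans (+-comm (det a b c) _) (sym e)))
               (+-zeroˡ 0≤cda 0≤abc (sym e))
        meet (tri< pos _ _) with i , _ , ik≡1 ← inverse pos =
          (i * z₁ , i * z₂) ,
          onSegment {l = det b c d} {m = det d a b} (subst (0ℚ <_) areas pos) 0≤bcd 0≤dab
            (scale z₁ (trans (cong (i *_) (sym areas)) ik≡1))
            (scale z₂ (trans (cong (i *_) (sym areas)) ik≡1)) ,
          onSegment {l = det c d a} {m = det a b c} pos 0≤cda 0≤abc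
            (trans (scale z₁ ik≡1) (crossing₁ (X a) (Y a) (X b) (Y b) (X c) (Y c) (X d) (Y d)))
            (trans (scale z₂ ik≡1) (crossing₂ (X a) (Y a) (X b) (Y b) (X c) (Y c) (X d) (Y d)))
          where
          z₁ = det b c d * X a + det d a b * X c
          z₂ = det b c d * Y a + det d a b * Y c
          scale : ∀ {k} z → i * k ≡ 1ℚ → k * (i * z) ≡ z
          scale {k} z e = trans (rearrange i k z) (trans (cong (_* z) e) (*-identityˡ z))
            where
            rearrange : ∀ i k z → k * (i * z) ≡ i * k * z
            rearrange = solve-∀ ℚ-ring

-- Shearing to make the abscissae distinct

module Shear {n : ℕ} (x y : Fin n → ℚ) (distinct : ∀ {i j} → x i ≡ x j → y i ≡ y j → i ≡ j) where

  shear : ℚ → Fin n → ℚ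
  shear δ i = x i + δ * y i

  -- Different abscissae stay different for small `δ`; points with equal abscissae have different
  -- ordinates, and any positive `δ` separates them.
  shear-injective : Small λ δ → ∀ i j → shear δ i ≡ shear δ j → i ≡ j
  shear-injective = Small-all λ i → Small-all λ j → separate i j
    where
    difference : ∀ δ a a′ b b′ → (a - b) + δ * (a′ - b′) ≡ (a + δ * a′) - (b + δ * b′)
    difference = solve-∀ ℚ-ring
    separate : ∀ i j → Small λ δ → shear δ i ≡ shear δ j → i ≡ j
    separate i j with ε , 0<ε , keep ← Small-sign (x i - x j) (y i - y j) = ε , 0<ε , λ δ 0<δ δ≤ε e →
      let zero : (x i - x j) + δ * (y i - y j) ≡ 0ℚ
          zero = trans (difference δ (x i) (y i) (x j) (y j))
                       (trans (cong (_- shear δ j) e) (+-inverseʳ (shear δ j)))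
      in decide δ 0<δ zero (λ b s → keep δ 0<δ δ≤ε b s) ((x i - x j) ≟ℚ 0ℚ) ((y i - y j) ≟ℚ 0ℚ)
      where
      decide : ∀ δ → 0ℚ < δ → (x i - x j) + δ * (y i - y j) ≡ 0ℚ →
               (∀ b → Sign b (x i - x j) → Sign b ((x i - x j) + δ * (y i - y j))) →
               Dec (x i - x j ≡ 0ℚ) → Dec (y i - y j ≡ 0ℚ) → i ≡ j
      decide δ 0<δ e keep (no x≢0)  _         = contradiction e (Sign⇒≢0 _ (keep _ (sign x≢0)))
      decide δ 0<δ e keep (yes x≡0) (yes y≡0) = distinct (x∙y⁻¹≈ε⇒x≈y _ _ x≡0) (x∙y⁻¹≈ε⇒x≈y _ _ y≡0)
      decide δ 0<δ e keep (yes x≡0) (no y≢0)  = contradiction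
        (trans (sym (trans (cong (_+ δ * (y i - y j)) x≡0) (+-identityˡ _))) e) (≢0-* (0≮0 0<δ) y≢0)

  -- A shear is affine, so the inverse shear keeps the parameter `t`.
  unshear : ∀ δ {p₁ p₂} i j → OnSegment (p₁ , p₂) (shear δ i , y i) (shear δ j , y j) →
            OnSegment (p₁ - δ * p₂ , p₂) (x i , y i) (x j , y j)
  unshear δ i j (t , 0≤t , t≤1 , refl , refl) = t , 0≤t , t≤1 , identity δ t (x i) (y i) (x j) (y j) , refl
    where
    identity : ∀ δ t a a′ b b′ → ((1ℚ - t) * (a + δ * a′) + t * (b + δ * b′)) -
      δ * ((1ℚ - t) * a′ + t * b′) ≡ (1ℚ - t) * a + t * b
    identity = solve-∀ ℚ-ring

module Realisation {n : ℕ} (pos : Fin n → Point) (pos-injective : ∀ {i j} → pos i ≡ pos j → i ≡ j) where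

  private
    Y : Fin n → ℚ
    Y = proj₂ ∘ pos

  open Shear (proj₁ ∘ pos) Y (λ e e′ → pos-injective (cong₂ _,_ e e′))

  private
    δ : ℚ
    δ = proj₁ shear-injective

    X : Fin n → ℚ
    X = shear δ

    X-injective : ∀ {i j} → X i ≡ X j → i ≡ j
    X-injective = proj₂ (proj₂ shear-injective) δ (proj₁ (proj₂ shear-injective)) ≤-refl _ _

  open GeneralPosition X Y using (det)
  open Perturbation X Y

  private
    faithful : Small λ ε → ∀ a b c s → Sign s (det a b c) → Sign s (det a b c + ε * vandermonde a b c)
    faithful = Small-all λ a → Small-all λ b → Small-all λ c → Small-sign (det a b c) (vandermonde a b c)

    ε : ℚ
    ε = proj₁ faithful

    0<ε : 0ℚ < ε
    0<ε = proj₁ (proj₂ faithful)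

    faithful-ε : Faithful ε
    faithful-ε = proj₂ (proj₂ faithful) ε 0<ε ≤-refl

  ω : Configuration n
  ω = configuration′ ε 0<ε X-injective faithful-ε

  -- The quadrilateral is formed by the sheared and bent points. `Quad⇒meet` undoes the bend, and
  -- `unshear` carries the common point of the two segments back to the drawing.
  crossing : ∀ {a b c d} → Configuration.Quad ω a b c d →
             ∃ λ p → OnSegment p (pos a) (pos c) × OnSegment p (pos b) (pos d)
  crossing {a} {b} {c} {d} (h₁ , h₂ , h₃ , h₄) =
    let (p₁ , p₂) , on , on′ = Quad⇒meet ε 0<ε X-injective faithful-ε a b c d
                                 (0< a b c h₁) (0< b c d h₂) (0< c d a h₃) (0< d a b h₄)
    in (p₁ - δ * p₂ , p₂) , unshear δ a c on , unshear δ b d on′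
    where
    0< : ∀ a b c → Configuration.O ω a b c → 0ℚ < GeneralPosition.det X (Y′ ε) a b c
    0< a b c = GeneralPosition.ccw⇒0< X (Y′ ε) X-injective (det′≢0 ε 0<ε X-injective faithful-ε)

-- The layers of a drawing as plane graphs on one configuration

module Layers {m n k : ℕ} (D : GeometricDrawing (K m n) k)
              (side : Fin k → Bool) (side-injective : ∀ {i j} → side i ≡ side j → i ≡ j) where
  open GeometricDrawing D

  vertex : Fin (m ℕ.+ n) → Fin m ⊎ Fin n
  vertex = splitAt m

  vertex-injective : ∀ {i j} → vertex i ≡ vertex j → i ≡ j
  vertex-injective {i} {j} e =
    trans (sym (join-splitAt m n i)) (trans (cong (join m n) e) (join-splitAt m n j))

  Adjacent : Bool → Fin m ⊎ Fin n → Fin m ⊎ Fin n → Set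
  Adjacent s (inj₁ a) (inj₂ b) = side (layer (a , b)) ≡ s
  Adjacent s (inj₂ b) (inj₁ a) = side (layer (a , b)) ≡ s
  Adjacent s _        _        = ⊥

  Adjacent? : ∀ s u v → Dec (Adjacent s u v)
  Adjacent? s (inj₁ a) (inj₂ b) = side (layer (a , b)) Bool.≟ s
  Adjacent? s (inj₂ b) (inj₁ a) = side (layer (a , b)) Bool.≟ s
  Adjacent? s (inj₁ _) (inj₁ _) = no id
  Adjacent? s (inj₂ _) (inj₂ _) = no id

  Adjacent-sym : ∀ s u v → Adjacent s u v → Adjacent s v u
  Adjacent-sym s (inj₁ a) (inj₂ b) e = e
  Adjacent-sym s (inj₂ b) (inj₁ a) e = e

  Adjacent-irr : ∀ s u → ¬ Adjacent s u u
  Adjacent-irr s (inj₁ a) ()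
  Adjacent-irr s (inj₂ b) ()

  edge : ∀ s u v → Adjacent s u v → ∃ λ e → side (layer e) ≡ s ×
         (∀ p → OnSegment p (pos u) (pos v) →
                OnSegment p (pos (proj₁ (ends (K m n) e))) (pos (proj₂ (ends (K m n) e)))) ×
         (∀ z → IsEnd (K m n) z e → z ≡ u ⊎ z ≡ v)
  edge s (inj₁ a) (inj₂ b) e = (a , b) , e , (λ p → id) , λ z → id
  edge s (inj₂ b) (inj₁ a) e = (a , b) , e , (λ p → segment-sym) ,
    λ { z (inj₁ h) → inj₂ h ; z (inj₂ h) → inj₁ h }

  disjoint : ∀ s {u v u′ v′} → Adjacent s u v → Adjacent s u′ v′ →
             (∀ z → z ≡ u ⊎ z ≡ v → ¬ (z ≡ u′ ⊎ z ≡ v′)) →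
             ¬ ∃ λ p → OnSegment p (pos u) (pos v) × OnSegment p (pos u′) (pos v′)
  disjoint s {u} {v} {u′} {v′} a a′ apart (p , on , on′)
    with e , es , seg , end ← edge s u v a
    with e′ , es′ , seg′ , end′ ← edge s u′ v′ a′
    with z , z∈e , z∈e′ , _ ← noCross e e′
           (λ { refl → apart _ (end _ (inj₁ refl)) (end′ _ (inj₁ refl)) })
           (side-injective (trans es (sym es′))) p (seg p on) (seg′ p on′)
    = apart z (end z z∈e) (end′ z z∈e′)

  position : Fin (m ℕ.+ n) → Point
  position = pos ∘ vertex

  open Realisation position (λ e → vertex-injective (pos-inj _ _ e)) public using (ω; crossing)
  open Configuration ω

  layerGraph : Bool → PlaneGraph ω
  layerGraph s = record
    { _~_    = λ i j → Adjacent s (vertex i) (vertex j)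
    ; _~?_   = λ i j → Adjacent? s (vertex i) (vertex j)
    ; ~-sym  = Adjacent-sym s _ _
    ; ~-irr  = Adjacent-irr s _
    ; planar = λ ac bd q@(abc , bcd , cda , dab) → disjoint s ac bd
        (λ { _ (inj₁ refl) (inj₁ e) → ≢₁₂ abc (vertex-injective e)
           ; _ (inj₁ refl) (inj₂ e) → ≢₁₂ dab (sym (vertex-injective e))
           ; _ (inj₂ refl) (inj₁ e) → ≢₁₂ bcd (sym (vertex-injective e))
           ; _ (inj₂ refl) (inj₂ e) → ≢₂₃ bcd (vertex-injective e) })
        (crossing q)
    }

  isLeft : Fin m ⊎ Fin n → Bool
  isLeft (inj₁ _) = true
  isLeft (inj₂ _) = false

  colour : Fin (m ℕ.+ n) → Bool
  colour = isLeft ∘ vertex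

  covered : ∀ u v → isLeft u ≢ isLeft v → Adjacent true u v ⊎ Adjacent false u v
  covered (inj₁ _) (inj₁ _) h = contradiction refl h
  covered (inj₂ _) (inj₂ _) h = contradiction refl h
  covered (inj₁ a) (inj₂ b) _ with side (layer (a , b))
  ... | true  = inj₁ refl
  ... | false = inj₂ refl
  covered (inj₂ b) (inj₁ a) _ with side (layer (a , b))
  ... | true  = inj₁ refl
  ... | false = inj₂ refl

  two-layers : Fin (m ℕ.+ n) → (∀ (a b : Fin (m ℕ.+ n)) → ∃ λ c → c ≢ a × c ≢ b) →
               sum₂ (λ p q → bichromatic (colour p) (colour q)) ℕ.+ 20 ℕ.≤ 8 ℕ.* (m ℕ.+ n)
  two-layers v₀ third =
    let _ , sub₁ , M₁ = saturate (layerGraph true)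
        _ , sub₂ , M₂ = saturate (layerGraph false)
    in two-layer-bound v₀ third colour M₁ M₂ λ {p} {q} h →
         Sum.map (sub₁ {p} {q}) (sub₂ {p} {q}) (covered (vertex p) (vertex q) h)

no-two-layers : ∀ {k} → GeometricDrawing (K 6 8) k →
                (side : Fin k → Bool) → (∀ {i j} → side i ≡ side j → i ≡ j) → ⊥
no-two-layers D side side-injective =
  -- The 48 edges contribute 96 over ordered pairs, so the bound claims 96 + 20 ≤ 8 · 14, that is
  -- 116 ≤ 112.
  ℕ.<⇒≱ (ℕ.m≤m+n 113 3) (Layers.two-layers D side side-injective 0F third)

lower-bound : ∀ k → GeometricDrawing (K 6 8) k → 3 ℕ.≤ k
lower-bound 0 D = ⊥-elim (no-two-layers D (λ ()) λ { {()} })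
lower-bound 1 D = ⊥-elim (no-two-layers D (λ _ → true) λ { {0F} {0F} _ → refl })
lower-bound 2 D = ⊥-elim (no-two-layers D side side-injective)
  where
  side : Fin 2 → Bool
  side 0F = true
  side 1F = false
  side-injective : ∀ {i j} → side i ≡ side j → i ≡ j
  side-injective {0F} {0F} _ = refl
  side-injective {1F} {1F} _ = refl
  side-injective {0F} {1F} ()
  side-injective {1F} {0F} ()
lower-bound (suc (suc (suc k))) D = s≤s (s≤s (s≤s z≤n))

-- A drawing in three layers

abscissa : Fin 6 → ℚ
abscissa 0F = 1ℚ
abscissa 1F = - 1ℚ
abscissa 2F = 1ℚ + 1ℚ
abscissa 3F = - (1ℚ + 1ℚ)
abscissa 4F = 1ℚ + 1ℚ + 1ℚ
abscissa 5F = - (1ℚ + 1ℚ + 1ℚ)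

pair : Fin 6 → Fin 3
pair 0F = 0F
pair 1F = 0F
pair 2F = 1F
pair 3F = 1F
pair 4F = 2F
pair 5F = 2F

height : ∀ {n} → Fin n → ℚ
height zero    = 1ℚ
height (suc j) = 1ℚ + height j

abscissa≢0 : ∀ i → abscissa i ≢ 0ℚ
abscissa≢0 = from-yes (all? λ i → ¬? (abscissa i ≟ℚ 0ℚ))

abscissa-injective : ∀ i j → abscissa i ≡ abscissa j → i ≡ j
abscissa-injective = from-yes (all? λ i → all? λ j → (abscissa i ≟ℚ abscissa j) →-dec (i ≟ j))

pair-opposite : ∀ i j → pair i ≡ pair j → i ≡ j ⊎ abscissa j ≡ - abscissa i
pair-opposite = from-yes (all? λ i → all? λ j →
  (pair i ≟ pair j) →-dec ((i ≟ j) ⊎-dec (abscissa j ≟ℚ - abscissa i)))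

0<height : ∀ {n} (j : Fin n) → 0ℚ < height j
0<height zero    = 0<1
0<height (suc j) = +-pos 0<1 (0<height j)

height-injective : ∀ {n} (i j : Fin n) → height i ≡ height j → i ≡ j
height-injective zero    zero    _ = refl
height-injective zero    (suc j) e =
  contradiction (∙-cancelˡ 1ℚ _ _ (trans (sym e) (sym (+-identityʳ 1ℚ)))) (0≮0 (0<height j))
height-injective (suc i) zero    e =
  contradiction (∙-cancelˡ 1ℚ _ _ (trans e (sym (+-identityʳ 1ℚ)))) (0≮0 (0<height i))
height-injective (suc i) (suc j) e = cong suc (height-injective i j (∙-cancelˡ 1ℚ _ _ e))

*-cancel-0 : ∀ {p q} → p * q ≡ 0ℚ → q ≢ 0ℚ → p ≡ 0ℚ
*-cancel-0 {p} e q≢0 with p ≟ℚ 0ℚ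
... | yes p≡0 = p≡0
... | no  p≢0 = contradiction e (≢0-* p≢0 q≢0)

-- The abscissa of `p` determines its parameter, which is therefore the same on both segments. If it
-- is zero, `p` is the common end; otherwise the ordinates give equal heights.
ray-meet : ∀ {x h h′ p} → x ≢ 0ℚ → OnSegment p (x , 0ℚ) (0ℚ , h) → OnSegment p (x , 0ℚ) (0ℚ , h′) →
           p ≡ (x , 0ℚ) ⊎ h ≡ h′
ray-meet {x} {h} {h′} {p₁ , p₂} x≢0 (t , _ , _ , e₁ , e₂) (s , _ , _ , e₁′ , e₂′) = decide (t ≟ℚ 0ℚ)
  where
  x-difference : ∀ s t x → (s - t) * x ≡ ((1ℚ - t) * x + t * 0ℚ) - ((1ℚ - s) * x + s * 0ℚ)
  x-difference = solve-∀ ℚ-ring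
  y-difference : ∀ t y z → (y - z) * t ≡ ((1ℚ - t) * 0ℚ + t * y) - ((1ℚ - t) * 0ℚ + t * z)
  y-difference = solve-∀ ℚ-ring
  x-start : ∀ x y → (1ℚ - 0ℚ) * x + 0ℚ * y ≡ x
  x-start = solve-∀ ℚ-ring
  s≡t : s ≡ t
  s≡t = x∙y⁻¹≈ε⇒x≈y s t (*-cancel-0
    (trans (x-difference s t x) (x≈y⇒x∙y⁻¹≈ε (trans (sym e₁) e₁′))) x≢0)
  at : ℚ → ℚ → ℚ → ℚ
  at t a b = (1ℚ - t) * a + t * b
  decide : Dec (t ≡ 0ℚ) → (p₁ , p₂) ≡ (x , 0ℚ) ⊎ h ≡ h′
  decide (yes t≡0) = inj₁ (cong₂ _,_
    (trans e₁ (trans (cong (λ t → at t x 0ℚ) t≡0) (x-start x 0ℚ)))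
    (trans e₂ (trans (cong (λ t → at t 0ℚ h) t≡0) (x-start 0ℚ h))))
  decide (no t≢0) = inj₂ (x∙y⁻¹≈ε⇒x≈y h h′ (*-cancel-0
    (trans (y-difference t h h′)
      (x≈y⇒x∙y⁻¹≈ε (trans (sym e₂) (trans e₂′ (cong (λ s → at s 0ℚ h′) s≡t))))) t≢0))

-- Comparing abscissae gives `(1ℚ - t) + (1ℚ - s) ≡ 0ℚ`. Both terms are nonnegative, so both
-- parameters are 1 and `p` is the end of both segments on the y-axis.
opposite-meet : ∀ {x h h′ p} → x ≢ 0ℚ → OnSegment p (x , 0ℚ) (0ℚ , h) →
                OnSegment p (- x , 0ℚ) (0ℚ , h′) → p ≡ (0ℚ , h) × h ≡ h′
opposite-meet {x} {h} {h′} {p₁ , p₂} x≢0 (t , _ , t≤1 , e₁ , e₂) (s , _ , s≤1 , e₁′ , e₂′) =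
  cong₂ _,_ p₁≡ p₂≡ , trans (sym p₂≡) p₂≡′
  where
  x-sum : ∀ s t x → ((1ℚ - t) + (1ℚ - s)) * x ≡ ((1ℚ - t) * x + t * 0ℚ) - ((1ℚ - s) * (- x) + s * 0ℚ)
  x-sum = solve-∀ ℚ-ring
  x-end : ∀ x y → (1ℚ - 1ℚ) * x + 1ℚ * y ≡ y
  x-end = solve-∀ ℚ-ring
  sum≡0 : (1ℚ - t) + (1ℚ - s) ≡ 0ℚ
  sum≡0 = *-cancel-0 (trans (x-sum s t x) (x≈y⇒x∙y⁻¹≈ε (trans (sym e₁) e₁′))) x≢0
  t≡1 : t ≡ 1ℚ
  t≡1 = sym (x∙y⁻¹≈ε⇒x≈y 1ℚ t (+-zeroˡ (≤⇒0≤ t≤1) (≤⇒0≤ s≤1) sum≡0))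
  s≡1 : s ≡ 1ℚ
  s≡1 = sym (x∙y⁻¹≈ε⇒x≈y 1ℚ s
    (+-zeroˡ (≤⇒0≤ s≤1) (≤⇒0≤ t≤1) (trans (+-comm (1ℚ - s) (1ℚ - t)) sum≡0)))
  at : ℚ → ℚ → ℚ → ℚ
  at t a b = (1ℚ - t) * a + t * b
  p₁≡ : p₁ ≡ 0ℚ
  p₁≡ = trans e₁ (trans (cong (λ t → at t x 0ℚ) t≡1) (x-end x 0ℚ))
  p₂≡ : p₂ ≡ h
  p₂≡ = trans e₂ (trans (cong (λ t → at t 0ℚ h) t≡1) (x-end 0ℚ h))
  p₂≡′ : p₂ ≡ h′
  p₂≡′ = trans e₂′ (trans (cong (λ s → at s 0ℚ h′) s≡1) (x-end 0ℚ h′))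

-- Each layer is a K₂,ₙ: two points of the x-axis on either side of the y-axis, which carries the other part.
upper-bound : ∀ {n} → GeometricDrawing (K 6 n) 3
upper-bound {n} = record
  { pos     = place
  ; pos-inj = place-injective
  ; layer   = λ (i , _) → pair i
  ; noCross = λ (i , j) (i′ , j′) e≢e′ same p → meet i j i′ j′ e≢e′ p (pair-opposite i i′ same)
  }
  where
  place : Fin 6 ⊎ Fin n → Point
  place (inj₁ i) = abscissa i , 0ℚ
  place (inj₂ j) = 0ℚ , height j

  place-injective : ∀ u v → place u ≡ place v → u ≡ v
  place-injective (inj₁ i) (inj₁ j) e = cong inj₁ (abscissa-injective i j (cong proj₁ e))
  place-injective (inj₁ i) (inj₂ j) e = contradiction (cong proj₁ e) (abscissa≢0 i)
  place-injective (inj₂ i) (inj₁ j) e = contradiction (cong proj₁ (sym e)) (abscissa≢0 j)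
  place-injective (inj₂ i) (inj₂ j) e = cong inj₂ (height-injective i j (cong proj₂ e))

  meet : ∀ i j i′ j′ → (i , j) ≢ (i′ , j′) → ∀ p → i ≡ i′ ⊎ abscissa i′ ≡ - abscissa i →
         OnSegment p (place (inj₁ i)) (place (inj₂ j)) → OnSegment p (place (inj₁ i′)) (place (inj₂ j′)) →
         Σ (Fin 6 ⊎ Fin n) λ v →
           (v ≡ inj₁ i ⊎ v ≡ inj₂ j) × (v ≡ inj₁ i′ ⊎ v ≡ inj₂ j′) × p ≡ place v
  meet i j .i j′ e≢e′ p (inj₁ refl) on on′ = decide (ray-meet (abscissa≢0 i) on on′)
    where
    decide : p ≡ place (inj₁ i) ⊎ height j ≡ height j′ → _
    decide (inj₁ e) = inj₁ i , inj₁ refl , inj₁ refl , e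
    decide (inj₂ e) = contradiction (cong (i ,_) (height-injective j j′ e)) e≢e′
  meet i j i′ j′ e≢e′ p (inj₂ opposite) on on′ =
    inj₂ j , inj₂ refl , inj₂ (cong inj₂ (height-injective j j′ (proj₂ common))) , proj₁ common
    where
    common = opposite-meet (abscissa≢0 i) on
      (subst (λ x → OnSegment p (x , 0ℚ) (place (inj₂ j′))) opposite on′)

theorem5p3 : GeometricThicknessIs (K 6 8) 3
theorem5p3 = upper-bound , lower-bound
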